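{- Let $\alpha_1,\alpha_2\in\mathbb{C}$. For $v\in\mathbb{Z}^2$ write $z_{ij}=x_{v+(i,j)}$ and $w_{ij}=y_{v+(i,j)}$, where $y$ denotes $\mathbf{y}_1$ at points of $\mathbb{Z}^2$ and $\mathbf{y}_2$ at points of $\mathbb{Z}^2+(\frac12,\frac12)$. (a) Suppose $\mathbf{x}=(x_s)\in(\mathbb{C}^*)^{\mathbb{Z}^2}$ satisfies, for all $v$, $$0=z_{00}^2z_{12}^2+z_{10}^2z_{02}^2+\tfrac{\alpha_2^2-\alpha_1^2}{4}z_{01}^2z_{11}^2-\alpha_1(z_{00}z_{02}z_{11}^2+z_{10}z_{12}z_{01}^2)-2z_{00}z_{10}z_{02}z_{12}-\alpha_2(z_{00}z_{12}z_{01}z_{11}+z_{10}z_{02}z_{01}z_{11}),$$ satisfies $\prod_{i=1}^4R^{B_i,0}_{w_i}(\mathbf{x})=R^{S_1,1}(\mathbf{x})R^{S_2,1}(\mathbf{x})R^{C_1,2}(\mathbf{x})R^{C_2,2}(\mathbf{x})$ for all $v$, and $R^{S,1}(\mathbf{x})\neq0$, $R^{C,2}(\mathbf{x})\neq0$ for all vertical segments $S$ of length $2$ and all unit squares $C$ with vertices in $\mathbb{Z}^2$. Then there exist $\mathbf{y}_1=(y_s)_{s\in\mathbb{Z}^2}$ and $\mathbf{y}_2=(y_s)_{s\in\mathbb{Z}^2+(\frac12,\frac12)}$ such that for all $v$: $z_{12}=\dfrac{\alpha_1z_{10}z_{01}^2+2z_{00}z_{10}z_{02}+\alpha_2z_{00}z_{01}z_{11}+w_{01}w_{\frac12\frac12}}{2z_{00}^2}$,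 $w_{11}=\dfrac{z_{10}w_{01}+w_{\frac12\frac12}}{z_{00}}$, $w_{\frac12\frac32}=\dfrac{z_{01}(\alpha_1z_{01}z_{10}+\alpha_2z_{00}z_{11})w_{01}+(\alpha_1z_{01}^2+2z_{00}z_{02})w_{\frac12\frac12}}{2z_{00}^2}$, $w_{01}^2=\alpha_1z_{01}^2+4z_{00}z_{02}$, $w_{\frac12\frac12}^2=\alpha_1(z_{00}^2z_{11}^2+z_{01}^2z_{10}^2)+2\alpha_2z_{00}z_{01}z_{10}z_{11}$. (b) Conversely, if $\mathbf{x}\in(\mathbb{C}^*)^{\mathbb{Z}^2}$, $\mathbf{y}_1\in\mathbb{C}^{\mathbb{Z}^2}$, $\mathbf{y}_2\in\mathbb{C}^{\mathbb{Z}^2+(\frac12,\frac12)}$ satisfy these five equations for all $v$, then $\mathbf{x}$ satisfies the displayed quartic equation and the product identity in (a) for all $v$.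
   Context: In the product identity, $B_1=v+[0,1]\times[0,2]$, $w_1=v+(1,2)$; $B_2=v+[-1,0]\times[0,2]$, $w_2=v+(-1,2)$; $B_3=v+[-1,0]\times[-1,1]$, $w_3=v+(-1,-1)$; $B_4=v+[0,1]\times[-1,1]$, $w_4=v+(1,-1)$; $S_1=v+\{0\}\times[0,2]$, $S_2=v+\{0\}\times[-1,1]$; $C_1=v+[0,1]^2$, $C_2=v+[-1,0]\times[0,1]$. For a $1\times2$ rectangle (width $1$ horizontal, height $2$ vertical) with corner $w=u+(\varepsilon_1,2\varepsilon_2)$ opposite the corner $u$, $\varepsilon_i\in\{\pm1\}$, put $z_{ij}=x_{u+(\varepsilon_1i,\varepsilon_2j)}$ and $R^{B,0}_w(\mathbf{x})=z_{00}^2z_{12}-\alpha_1z_{10}z_{01}^2-2z_{00}z_{10}z_{02}-\alpha_2z_{00}z_{01}z_{11}$. For a vertical segment $S$ with lattice points $z_{00},z_{01},z_{02}$ in order, $R^{S,1}(\mathbf{x})=\alpha_1z_{01}^2+4z_{00}z_{02}$. For a unit square $C$ with vertex values $z_{00},z_{01},z_{10},z_{11}$ (via $C\cong\{0,1\}^2$), $R^{C,2}(\mathbf{x})=\alpha_1(z_{00}^2z_{11}^2+z_{01}^2z_{10}^2)+2\alpha_2z_{00}z_{01}z_{10}z_{11}$.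
   Formalization: The leading term of R^{B,0}_w is taken as 2z_{00}^2z_{12} instead of z_{00}^2z_{12}, since (b) fails as printed (α_1=α_2=0, x≡1, y_1≡2, y_2≡0 gives 1=0); "nonzero" is read as |z|^2>0. -}

module Defs where

open import Data.Integer.Base as ℤ using (ℤ; +_; -[1+_]; _◃_)
open import Data.Nat.Base as ℕ using (ℕ)
import Data.Nat.Properties as ℕ
open import Data.Product using (∃-syntax; _×_; _,_)
open import Data.Rational.Base as ℚ using (ℚ; 0ℚ; 1ℚ; ½)
import Data.Rational.Properties as ℚ
open import Data.Rational.Solver using (module +-*-Solver)
open import Data.Sign.Base as Sign using (Sign)
open import Relation.Binary.PropositionalEquality
  using (_≡_; _≢_; refl; sym; trans; cong; cong₂; subst)
open import Relation.Nullary.Decidable.Core using (yes; no; from-yes)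
open import Relation.Nullary.Negation.Core using (contradiction)

recip : ℚ → ℚ
recip p with p ℚ.≟ 0ℚ
... | yes _   = 0ℚ
... | no  p≢0 = (ℚ.1/ p) {{ℚ.≢-nonZero p≢0}}

>0⇒≢0 : ∀ {p} → 0ℚ ℚ.< p → p ≢ 0ℚ
>0⇒≢0 0<p p≡0 = ℚ.<-irrefl (sym p≡0) 0<p

*-recip : ∀ p → 0ℚ ℚ.< p → p ℚ.* recip p ≡ 1ℚ
*-recip p 0<p with p ℚ.≟ 0ℚ
... | yes p≡0 = contradiction p≡0 (>0⇒≢0 0<p)
... | no  p≢0 = ℚ.*-inverseʳ p {{ℚ.≢-nonZero p≢0}}

recip>0 : ∀ p → 0ℚ ℚ.< p → 0ℚ ℚ.< recip p
recip>0 p 0<p with p ℚ.≟ 0ℚ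
... | yes p≡0 = contradiction p≡0 (>0⇒≢0 0<p)
... | no  p≢0 = ℚ.positive⁻¹ _ {{ℚ.1/pos⇒pos p {{ℚ.positive 0<p}}}}

*>0 : ∀ p q → 0ℚ ℚ.< p → 0ℚ ℚ.< q → 0ℚ ℚ.< p ℚ.* q
*>0 p q 0<p 0<q =
  ℚ.positive⁻¹ (p ℚ.* q) {{ℚ.pos*pos⇒pos p {{ℚ.positive 0<p}} q {{ℚ.positive 0<q}}}}

*-mono-≤ : ∀ p q r s → 0ℚ ℚ.≤ p → 0ℚ ℚ.≤ s → p ℚ.≤ q → r ℚ.≤ s →
           p ℚ.* r ℚ.≤ q ℚ.* s
*-mono-≤ p q r s 0≤p 0≤s p≤q r≤s = ℚ.≤-trans
  (ℚ.*-monoˡ-≤-nonNeg p {{ℚ.nonNegative 0≤p}} r≤s)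
  (ℚ.*-monoʳ-≤-nonNeg s {{ℚ.nonNegative 0≤s}} p≤q)

recip-anti : ∀ p q → 0ℚ ℚ.< p → p ℚ.≤ q → recip q ℚ.≤ recip p
recip-anti p q 0<p p≤q = begin
  recip q                        ≡⟨ ℚ.*-identityˡ (recip q) ⟨
  1ℚ ℚ.* recip q                 ≡⟨ cong (ℚ._* recip q) (*-recip p 0<p) ⟨
  (p ℚ.* recip p) ℚ.* recip q    ≤⟨ ℚ.*-monoʳ-≤-nonNeg (recip q) {{nn q 0<q}}
                                     (ℚ.*-monoʳ-≤-nonNeg (recip p) {{nn p 0<p}} p≤q) ⟩
  (q ℚ.* recip p) ℚ.* recip q    ≡⟨ solve 3 (λ a b c → (a :* b) :* c := (a :* c) :* b) refl
                                     q (recip p) (recip q) ⟩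
  (q ℚ.* recip q) ℚ.* recip p    ≡⟨ cong (ℚ._* recip p) (*-recip q 0<q) ⟩
  1ℚ ℚ.* recip p                 ≡⟨ ℚ.*-identityˡ (recip p) ⟩
  recip p                        ∎
  where
  open ℚ.≤-Reasoning
  open +-*-Solver
  0<q : 0ℚ ℚ.< q
  0<q = ℚ.<-≤-trans 0<p p≤q
  nn : ∀ r → 0ℚ ℚ.< r → ℚ.NonNegative (recip r)
  nn r 0<r = ℚ.nonNegative (ℚ.<⇒≤ (recip>0 r 0<r))

half>0 : ∀ ε → 0ℚ ℚ.< ε → 0ℚ ℚ.< ½ ℚ.* ε
half>0 ε = *>0 ½ ε (from-yes (0ℚ ℚ.<? ½))

half+half : ∀ ε → ½ ℚ.* ε ℚ.+ ½ ℚ.* ε ≡ ε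
half+half ε = trans (sym (ℚ.*-distribʳ-+ ε ½ ½)) (ℚ.*-identityˡ ε)

∣-∣-comm : ∀ p q → ℚ.∣ p ℚ.- q ∣ ≡ ℚ.∣ q ℚ.- p ∣
∣-∣-comm p q = trans (sym (ℚ.∣-p∣≡∣p∣ (p ℚ.- q))) (cong ℚ.∣_∣
  (solve 2 (λ a b → :- (a :- b) := b :- a) refl p q))
  where open +-*-Solver

-- Real numbers: Cauchy sequences of rationals (the existential carries
-- the modulus), with the setoid equality _≈ᴿ_.

Cauchy : (ℕ → ℚ) → Set
Cauchy s = ∀ ε → 0ℚ ℚ.< ε →
  ∃[ N ] (∀ m n → N ℕ.≤ m → N ℕ.≤ n → ℚ.∣ s m ℚ.- s n ∣ ℚ.< ε)

record ℝ : Set where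
  constructor mkℝ
  field
    seq    : ℕ → ℚ
    cauchy : Cauchy seq

open ℝ public

infix 4 _≈ᴿ_

_≈ᴿ_ : ℝ → ℝ → Set
a ≈ᴿ b = ∀ ε → 0ℚ ℚ.< ε →
  ∃[ N ] (∀ n → N ℕ.≤ n → ℚ.∣ seq a n ℚ.- seq b n ∣ ℚ.< ε)

Positiveᴿ : ℝ → Set
Positiveᴿ a = ∃[ ε ] (0ℚ ℚ.< ε × ∃[ N ] (∀ n → N ℕ.≤ n → ε ℚ.≤ seq a n))

fromℚᴿ : ℚ → ℝ
fromℚᴿ q = mkℝ (λ _ → q) λ ε 0<ε → 0 , λ _ _ _ _ →
  subst (ℚ._< ε) (sym (cong ℚ.∣_∣ (ℚ.+-inverseʳ q))) 0<ε

+-cauchy : ∀ {s t} → Cauchy s → Cauchy t → Cauchy (λ n → s n ℚ.+ t n)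
+-cauchy {s} {t} cs ct ε 0<ε =
  let M , hs = cs (½ ℚ.* ε) (half>0 ε 0<ε)
      N , ht = ct (½ ℚ.* ε) (half>0 ε 0<ε)
  in M ℕ.⊔ N , λ m n M⊔N≤m M⊔N≤n → let open ℚ.≤-Reasoning in
  begin-strict
    ℚ.∣ (s m ℚ.+ t m) ℚ.- (s n ℚ.+ t n) ∣
      ≡⟨ cong ℚ.∣_∣ (rearrange (s m) (t m) (s n) (t n)) ⟩
    ℚ.∣ (s m ℚ.- s n) ℚ.+ (t m ℚ.- t n) ∣
      ≤⟨ ℚ.∣p+q∣≤∣p∣+∣q∣ (s m ℚ.- s n) (t m ℚ.- t n) ⟩
    ℚ.∣ s m ℚ.- s n ∣ ℚ.+ ℚ.∣ t m ℚ.- t n ∣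
      <⟨ ℚ.+-mono-<
           (hs m n (ℕ.m⊔n≤o⇒m≤o M N M⊔N≤m) (ℕ.m⊔n≤o⇒m≤o M N M⊔N≤n))
           (ht m n (ℕ.m⊔n≤o⇒n≤o M N M⊔N≤m) (ℕ.m⊔n≤o⇒n≤o M N M⊔N≤n)) ⟩
    ½ ℚ.* ε ℚ.+ ½ ℚ.* ε
      ≡⟨ half+half ε ⟩
    ε ∎
  where
  rearrange : ∀ a b c d → (a ℚ.+ b) ℚ.- (c ℚ.+ d) ≡ (a ℚ.- c) ℚ.+ (b ℚ.- d)
  rearrange = solve 4 (λ a b c d → (a :+ b) :- (c :+ d) := (a :- c) :+ (b :- d)) refl
    where open +-*-Solver

neg-cauchy : ∀ {s} → Cauchy s → Cauchy (λ n → ℚ.- s n)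
neg-cauchy {s} cs ε 0<ε with cs ε 0<ε
... | N , hs = N , λ m n N≤m N≤n → subst (ℚ._< ε)
  (trans (∣-∣-comm (s m) (s n)) (cong ℚ.∣_∣ (flip (s m) (s n)))) (hs m n N≤m N≤n)
  where
  flip : ∀ a b → b ℚ.- a ≡ (ℚ.- a) ℚ.- (ℚ.- b)
  flip = solve 2 (λ a b → b :- a := (:- a) :- (:- b)) refl
    where open +-*-Solver

cauchy-bounded : ∀ {s} → Cauchy s →
  ∃[ B ] (0ℚ ℚ.< B × ∃[ N ] (∀ n → N ℕ.≤ n → ℚ.∣ s n ∣ ℚ.≤ B))
cauchy-bounded {s} cs with cs 1ℚ (from-yes (0ℚ ℚ.<? 1ℚ))
... | N , hs = ℚ.∣ s N ∣ ℚ.+ 1ℚ ,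
  ℚ.+-mono-≤-< (ℚ.0≤∣p∣ (s N)) (from-yes (0ℚ ℚ.<? 1ℚ)) ,
  N , λ n N≤n → let open ℚ.≤-Reasoning in begin
    ℚ.∣ s n ∣                            ≡⟨ cong ℚ.∣_∣ (split (s n) (s N)) ⟩
    ℚ.∣ s N ℚ.+ (s n ℚ.- s N) ∣          ≤⟨ ℚ.∣p+q∣≤∣p∣+∣q∣ (s N) (s n ℚ.- s N) ⟩
    ℚ.∣ s N ∣ ℚ.+ ℚ.∣ s n ℚ.- s N ∣      ≤⟨ ℚ.+-monoʳ-≤ ℚ.∣ s N ∣
                                             (ℚ.<⇒≤ (hs n N N≤n ℕ.≤-refl)) ⟩
    ℚ.∣ s N ∣ ℚ.+ 1ℚ                     ∎
  where
  split : ∀ a b → a ≡ b ℚ.+ (a ℚ.- b)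
  split = solve 2 (λ a b → a := b :+ (a :- b)) refl
    where open +-*-Solver

*-cauchy : ∀ {s t} → Cauchy s → Cauchy t → Cauchy (λ n → s n ℚ.* t n)
*-cauchy {s} {t} cs ct ε 0<ε =
  let A , 0<A , K , bs = cauchy-bounded cs
      B , 0<B , L , bt = cauchy-bounded ct
      M , hs = cs (½ ℚ.* ε ℚ.* recip B)
                  (*>0 (½ ℚ.* ε) (recip B) (half>0 ε 0<ε) (recip>0 B 0<B))
      N , ht = ct (½ ℚ.* ε ℚ.* recip A)
                  (*>0 (½ ℚ.* ε) (recip A) (half>0 ε 0<ε) (recip>0 A 0<A))
  in (K ℕ.⊔ L) ℕ.⊔ (M ℕ.⊔ N) , λ m n ≤m ≤n →
  let open ℚ.≤-Reasoning
      KL≤m = ℕ.m⊔n≤o⇒m≤o (K ℕ.⊔ L) (M ℕ.⊔ N) ≤m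
      KL≤n = ℕ.m⊔n≤o⇒m≤o (K ℕ.⊔ L) (M ℕ.⊔ N) ≤n
      MN≤m = ℕ.m⊔n≤o⇒n≤o (K ℕ.⊔ L) (M ℕ.⊔ N) ≤m
      MN≤n = ℕ.m⊔n≤o⇒n≤o (K ℕ.⊔ L) (M ℕ.⊔ N) ≤n
      ∣s∣≤A = bs m (ℕ.m⊔n≤o⇒m≤o K L KL≤m)
      ∣t∣≤B = bt n (ℕ.m⊔n≤o⇒n≤o K L KL≤n)
      Δs = hs m n (ℕ.m⊔n≤o⇒m≤o M N MN≤m) (ℕ.m⊔n≤o⇒m≤o M N MN≤n)
      Δt = ht m n (ℕ.m⊔n≤o⇒n≤o M N MN≤m) (ℕ.m⊔n≤o⇒n≤o M N MN≤n)
  in begin-strict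
    ℚ.∣ s m ℚ.* t m ℚ.- s n ℚ.* t n ∣
      ≡⟨ cong ℚ.∣_∣ (split (s m) (t m) (s n) (t n)) ⟩
    ℚ.∣ s m ℚ.* (t m ℚ.- t n) ℚ.+ t n ℚ.* (s m ℚ.- s n) ∣
      ≤⟨ ℚ.∣p+q∣≤∣p∣+∣q∣ (s m ℚ.* (t m ℚ.- t n)) (t n ℚ.* (s m ℚ.- s n)) ⟩
    ℚ.∣ s m ℚ.* (t m ℚ.- t n) ∣ ℚ.+ ℚ.∣ t n ℚ.* (s m ℚ.- s n) ∣
      <⟨ ℚ.+-mono-< (bound (s m) (t m ℚ.- t n) A (½ ℚ.* ε) 0<A ∣s∣≤A Δt)
                    (bound (t n) (s m ℚ.- s n) B (½ ℚ.* ε) 0<B ∣t∣≤B Δs) ⟩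
    ½ ℚ.* ε ℚ.+ ½ ℚ.* ε
      ≡⟨ half+half ε ⟩
    ε ∎
  where
  split : ∀ a b c d → a ℚ.* b ℚ.- c ℚ.* d ≡ a ℚ.* (b ℚ.- d) ℚ.+ d ℚ.* (a ℚ.- c)
  split = solve 4 (λ a b c d → a :* b :- c :* d := a :* (b :- d) :+ d :* (a :- c)) refl
    where open +-*-Solver
  bound : ∀ p q C δ → 0ℚ ℚ.< C → ℚ.∣ p ∣ ℚ.≤ C → ℚ.∣ q ∣ ℚ.< δ ℚ.* recip C →
          ℚ.∣ p ℚ.* q ∣ ℚ.< δ
  bound p q C δ 0<C ∣p∣≤C ∣q∣<δ/C = begin-strict
    ℚ.∣ p ℚ.* q ∣              ≡⟨ ℚ.∣p*q∣≡∣p∣*∣q∣ p q ⟩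
    ℚ.∣ p ∣ ℚ.* ℚ.∣ q ∣        ≤⟨ ℚ.*-monoʳ-≤-nonNeg ℚ.∣ q ∣
                                   {{ℚ.nonNegative (ℚ.0≤∣p∣ q)}} ∣p∣≤C ⟩
    C ℚ.* ℚ.∣ q ∣              <⟨ ℚ.*-monoʳ-<-pos C {{ℚ.positive 0<C}} ∣q∣<δ/C ⟩
    C ℚ.* (δ ℚ.* recip C)      ≡⟨ swap C δ (recip C) ⟩
    δ ℚ.* (C ℚ.* recip C)      ≡⟨ cong (δ ℚ.*_) (*-recip C 0<C) ⟩
    δ ℚ.* 1ℚ                   ≡⟨ ℚ.*-identityʳ δ ⟩
    δ                          ∎
    where
    open ℚ.≤-Reasoning
    swap : ∀ a b c → a ℚ.* (b ℚ.* c) ≡ b ℚ.* (a ℚ.* c)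
    swap = solve 3 (λ a b c → a :* (b :* c) := b :* (a :* c)) refl
      where open +-*-Solver

recip-cauchy : (a : ℝ) → Positiveᴿ a → Cauchy (λ n → recip (seq a n))
recip-cauchy a (δ , 0<δ , K , δ≤a) ε 0<ε
  = let N , ha = cauchy a (ε ℚ.* (δ ℚ.* δ)) (*>0 ε (δ ℚ.* δ) 0<ε (*>0 δ δ 0<δ 0<δ))
    in K ℕ.⊔ N , λ m n K⊔N≤m K⊔N≤n →
  let δ≤p = δ≤a m (ℕ.m⊔n≤o⇒m≤o K N K⊔N≤m)
      δ≤q = δ≤a n (ℕ.m⊔n≤o⇒m≤o K N K⊔N≤n)
  in bound (seq a m) (seq a n) δ≤p δ≤q
       (ha m n (ℕ.m⊔n≤o⇒n≤o K N K⊔N≤m) (ℕ.m⊔n≤o⇒n≤o K N K⊔N≤n))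
  where
  open +-*-Solver
  bound : ∀ p q → δ ℚ.≤ p → δ ℚ.≤ q → ℚ.∣ p ℚ.- q ∣ ℚ.< ε ℚ.* (δ ℚ.* δ) →
          ℚ.∣ recip p ℚ.- recip q ∣ ℚ.< ε
  bound p q δ≤p δ≤q Δ = begin-strict
    ℚ.∣ p′ ℚ.- q′ ∣
      ≡⟨ cong ℚ.∣_∣ eq ⟩
    ℚ.∣ (q ℚ.- p) ℚ.* (p′ ℚ.* q′) ∣
      ≡⟨ ℚ.∣p*q∣≡∣p∣*∣q∣ (q ℚ.- p) (p′ ℚ.* q′) ⟩
    ℚ.∣ q ℚ.- p ∣ ℚ.* ℚ.∣ p′ ℚ.* q′ ∣
      ≡⟨ cong₂ ℚ._*_ (∣-∣-comm q p) (ℚ.0≤p⇒∣p∣≡p (ℚ.<⇒≤ (*>0 p′ q′ 0<p′ 0<q′))) ⟩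
    ℚ.∣ p ℚ.- q ∣ ℚ.* (p′ ℚ.* q′)
      ≤⟨ ℚ.*-monoˡ-≤-nonNeg ℚ.∣ p ℚ.- q ∣ {{ℚ.nonNegative (ℚ.0≤∣p∣ (p ℚ.- q))}}
           (*-mono-≤ p′ δ′ q′ δ′ (ℚ.<⇒≤ 0<p′) (ℚ.<⇒≤ 0<δ′) (recip-anti δ p 0<δ δ≤p) (recip-anti δ q 0<δ δ≤q)) ⟩
    ℚ.∣ p ℚ.- q ∣ ℚ.* (δ′ ℚ.* δ′)
      <⟨ ℚ.*-monoˡ-<-pos (δ′ ℚ.* δ′) {{ℚ.positive (*>0 δ′ δ′ 0<δ′ 0<δ′)}} Δ ⟩
    (ε ℚ.* (δ ℚ.* δ)) ℚ.* (δ′ ℚ.* δ′)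
      ≡⟨ solve 3 (λ e d d′ → (e :* (d :* d)) :* (d′ :* d′) := e :* ((d :* d′) :* (d :* d′)))
           refl ε δ δ′ ⟩
    ε ℚ.* ((δ ℚ.* δ′) ℚ.* (δ ℚ.* δ′))
      ≡⟨ cong (λ u → ε ℚ.* (u ℚ.* u)) (*-recip δ 0<δ) ⟩
    ε ℚ.* 1ℚ
      ≡⟨ ℚ.*-identityʳ ε ⟩
    ε ∎
    where
    open ℚ.≤-Reasoning
    p′ q′ δ′ : ℚ
    p′ = recip p
    q′ = recip q
    δ′ = recip δ
    0<p : 0ℚ ℚ.< p
    0<p = ℚ.<-≤-trans 0<δ δ≤p
    0<q : 0ℚ ℚ.< q
    0<q = ℚ.<-≤-trans 0<δ δ≤q
    0<p′ : 0ℚ ℚ.< p′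
    0<p′ = recip>0 p 0<p
    0<q′ : 0ℚ ℚ.< q′
    0<q′ = recip>0 q 0<q
    0<δ′ : 0ℚ ℚ.< δ′
    0<δ′ = recip>0 δ 0<δ
    eq : p′ ℚ.- q′ ≡ (q ℚ.- p) ℚ.* (p′ ℚ.* q′)
    eq = trans
      (cong₂ ℚ._-_
        (trans (sym (ℚ.*-identityˡ p′)) (cong (ℚ._* p′) (sym (*-recip q 0<q))))
        (trans (sym (ℚ.*-identityˡ q′)) (cong (ℚ._* q′) (sym (*-recip p 0<p)))))
      (solve 4 (λ a b c d → (b :* d) :* c :- (a :* c) :* d := (b :- a) :* (c :* d))
        refl p q p′ q′)

infixl 6 _+ᴿ_ _-ᴿ_
infixl 7 _*ᴿ_
infix  8 -ᴿ_

_+ᴿ_ _*ᴿ_ : ℝ → ℝ → ℝ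
a +ᴿ b = mkℝ (λ n → seq a n ℚ.+ seq b n) (+-cauchy {seq a} {seq b} (cauchy a) (cauchy b))
a *ᴿ b = mkℝ (λ n → seq a n ℚ.* seq b n) (*-cauchy {seq a} {seq b} (cauchy a) (cauchy b))

-ᴿ_ : ℝ → ℝ
-ᴿ a = mkℝ (λ n → ℚ.- seq a n) (neg-cauchy {seq a} (cauchy a))

_-ᴿ_ : ℝ → ℝ → ℝ
a -ᴿ b = a +ᴿ (-ᴿ b)

invᴿ : (a : ℝ) → Positiveᴿ a → ℝ
invᴿ a a>0 = mkℝ (λ n → recip (seq a n)) (recip-cauchy a a>0)

infix 5 _+i_

record ℂ : Set where
  constructor _+i_
  field
    re im : ℝ

open ℂ public

infix  4 _≈_
infixl 6 _+_ _-_
infixl 7 _*_ _/_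
infixl 7 _*ˣ_
infix  8 _²

_≈_ : ℂ → ℂ → Set
z ≈ w = (re z ≈ᴿ re w) × (im z ≈ᴿ im w)

_+_ _-_ _*_ : ℂ → ℂ → ℂ
z + w = (re z +ᴿ re w) +i (im z +ᴿ im w)
z - w = (re z -ᴿ re w) +i (im z -ᴿ im w)
z * w = (re z *ᴿ re w -ᴿ im z *ᴿ im w) +i (re z *ᴿ im w +ᴿ im z *ᴿ re w)

_² : ℂ → ℂ
z ² = z * z

fromℚ : ℚ → ℂ
fromℚ q = fromℚᴿ q +i fromℚᴿ 0ℚ

0ℂ 2ℂ 4ℂ : ℂ
0ℂ = fromℚ 0ℚ
2ℂ = fromℚ (+ 2 ℚ./ 1)
4ℂ = fromℚ (+ 4 ℚ./ 1)

normSq : ℂ → ℝ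
normSq z = re z *ᴿ re z +ᴿ im z *ᴿ im z

-- z ≠ 0 in its positive form |z|² > 0, i.e. z is apart from 0. This is
-- what makes z invertible without appeal to Markov's principle.
Nonzero : ℂ → Set
Nonzero z = Positiveᴿ (normSq z)

record ℂˣ : Set where
  constructor mkℂˣ
  field
    val     : ℂ
    nonzero : Nonzero val

open ℂˣ public

*-nonzero : ∀ z w → Nonzero z → Nonzero w → Nonzero (z * w)
*-nonzero z w (δ , 0<δ , M , hz) (ε , 0<ε , N , hw) =
  δ ℚ.* ε , *>0 δ ε 0<δ 0<ε , M ℕ.⊔ N , λ n M⊔N≤n →
  let hzn = hz n (ℕ.m⊔n≤o⇒m≤o M N M⊔N≤n)
      hwn = hw n (ℕ.m⊔n≤o⇒n≤o M N M⊔N≤n)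
  in ℚ.≤-trans
       (*-mono-≤ δ (seq (normSq z) n) ε (seq (normSq w) n) (ℚ.<⇒≤ 0<δ) (ℚ.≤-trans (ℚ.<⇒≤ 0<ε) hwn) hzn hwn)
       (ℚ.≤-reflexive (brahmagupta (seq (re z) n) (seq (im z) n) (seq (re w) n) (seq (im w) n)))
  where
  brahmagupta : ∀ a b c d →
    (a ℚ.* a ℚ.+ b ℚ.* b) ℚ.* (c ℚ.* c ℚ.+ d ℚ.* d) ≡
    (a ℚ.* c ℚ.- b ℚ.* d) ℚ.* (a ℚ.* c ℚ.- b ℚ.* d) ℚ.+
    (a ℚ.* d ℚ.+ b ℚ.* c) ℚ.* (a ℚ.* d ℚ.+ b ℚ.* c)
  brahmagupta = solve 4 (λ a b c d →
    (a :* a :+ b :* b) :* (c :* c :+ d :* d) :=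
    (a :* c :- b :* d) :* (a :* c :- b :* d) :+
    (a :* d :+ b :* c) :* (a :* d :+ b :* c)) refl
    where open +-*-Solver

_*ˣ_ : ℂˣ → ℂˣ → ℂˣ
mkℂˣ z z≠0 *ˣ mkℂˣ w w≠0 = mkℂˣ (z * w) (*-nonzero z w z≠0 w≠0)

2ˣ 4ˣ : ℂˣ
2ˣ = mkℂˣ 2ℂ (1ℚ , from-yes (0ℚ ℚ.<? 1ℚ) , 0 , λ n _ → from-yes (1ℚ ℚ.≤? seq (normSq 2ℂ) n))
4ˣ = mkℂˣ 4ℂ (1ℚ , from-yes (0ℚ ℚ.<? 1ℚ) , 0 , λ n _ → from-yes (1ℚ ℚ.≤? seq (normSq 4ℂ) n))

-- z⁻¹ = z̄ / |z|²
inv : ℂˣ → ℂ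
inv (mkℂˣ z z≠0) = (re z *ᴿ r) +i ((-ᴿ im z) *ᴿ r)
  where r = invᴿ (normSq z) z≠0

_/_ : ℂ → ℂˣ → ℂ
z / w = z * inv w

ℤ² : Set
ℤ² = ℤ × ℤ

infixl 6 _⊕_

_⊕_ : ℤ² → ℤ² → ℤ²
(a , b) ⊕ (c , d) = (a ℤ.+ c) , (b ℤ.+ d)

-- (a , b) +½½ stands for the point (a + ½ , b + ½).
record ℤ²½ : Set where
  constructor _+½½
  field
    corner : ℤ²

module _ (α₁ α₂ : ℂ) (x : ℤ² → ℂˣ) where

  -- R^{B,0}_w for the 1×2 rectangle B with corner u and opposite corner
  -- w = u + (ε₁ , 2ε₂). It is the derivative in z₁₂ of the polynomial in
  -- Quartic, so the leading term is 2z₀₀²z₁₂. With z₀₀²z₁₂ instead, the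
  -- product identity would not follow from System: for α₁ = α₂ = 0,
  -- x ≡ 1, y₁ ≡ 2, y₂ ≡ 0 all of System holds, while the four factors
  -- would be -1 and the right-hand side 0.
  Rᴮ : ℤ² → Sign → Sign → ℂ
  Rᴮ u ε₁ ε₂ =
    2ℂ * z 0 0 ² * z 1 2
      - α₁ * z 1 0 * z 0 1 ²
      - 2ℂ * z 0 0 * z 1 0 * z 0 2
      - α₂ * z 0 0 * z 0 1 * z 1 1
    where
    z : ℕ → ℕ → ℂ
    z i j = val (x (u ⊕ (ε₁ ◃ i , ε₂ ◃ j)))

  -- R^{S,1} for S = v + {0}×[0,2]
  Rˢ : ℤ² → ℂ
  Rˢ v = α₁ * z 0 1 ² + 4ℂ * z 0 0 * z 0 2
    where
    z : ℕ → ℕ → ℂ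
    z i j = val (x (v ⊕ (+ i , + j)))

  -- R^{C,2} for C = v + [0,1]²
  Rᶜ : ℤ² → ℂ
  Rᶜ v = α₁ * (z 0 0 ² * z 1 1 ² + z 0 1 ² * z 1 0 ²)
       + 2ℂ * α₂ * z 0 0 * z 0 1 * z 1 0 * z 1 1
    where
    z : ℕ → ℕ → ℂ
    z i j = val (x (v ⊕ (+ i , + j)))

  Quartic : ℤ² → Set
  Quartic v = 0ℂ ≈
      z 0 0 ² * z 1 2 ² + z 1 0 ² * z 0 2 ²
    + (α₂ ² - α₁ ²) / 4ˣ * z 0 1 ² * z 1 1 ²
    - α₁ * (z 0 0 * z 0 2 * z 1 1 ² + z 1 0 * z 1 2 * z 0 1 ²)
    - 2ℂ * z 0 0 * z 1 0 * z 0 2 * z 1 2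
    - α₂ * (z 0 0 * z 1 2 * z 0 1 * z 1 1 + z 1 0 * z 0 2 * z 0 1 * z 1 1)
    where
    z : ℕ → ℕ → ℂ
    z i j = val (x (v ⊕ (+ i , + j)))

  -- B₁, B₂ have w₁, w₂ opposite to v, and B₃, B₄ have w₃, w₄ opposite to
  -- v + (0,1). S₂ starts at v + (0,-1), and C₂ at v + (-1,0).
  ProductIdentity : ℤ² → Set
  ProductIdentity v =
      Rᴮ v Sign.+ Sign.+
    * Rᴮ v Sign.- Sign.+
    * Rᴮ (v ⊕ (+ 0 , + 1)) Sign.- Sign.-
    * Rᴮ (v ⊕ (+ 0 , + 1)) Sign.+ Sign.-
    ≈ Rˢ v
    * Rˢ (v ⊕ (+ 0 , -[1+ 0 ]))
    * Rᶜ v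
    * Rᶜ (v ⊕ (-[1+ 0 ] , + 0))

  module _ (y₁ : ℤ² → ℂ) (y₂ : ℤ²½ → ℂ) (v : ℤ²) where

    private
      zˣ : ℕ → ℕ → ℂˣ
      zˣ i j = x (v ⊕ (+ i , + j))

      z w : ℕ → ℕ → ℂ
      z i j = val (zˣ i j)
      w i j = y₁ (v ⊕ (+ i , + j))

      w½½ w½³⁄₂ : ℂ
      w½½   = y₂ (v +½½)
      w½³⁄₂ = y₂ ((v ⊕ (+ 0 , + 1)) +½½)

    record System : Set where
      field
        z₁₂-eq : z 1 2 ≈
          ( α₁ * z 1 0 * z 0 1 ² + 2ℂ * z 0 0 * z 1 0 * z 0 2
          + α₂ * z 0 0 * z 0 1 * z 1 1 + w 0 1 * w½½ )
          / (2ˣ *ˣ (zˣ 0 0 *ˣ zˣ 0 0))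
        w₁₁-eq : w 1 1 ≈ (z 1 0 * w 0 1 + w½½) / zˣ 0 0
        w½³⁄₂-eq : w½³⁄₂ ≈
          ( z 0 1 * (α₁ * z 0 1 * z 1 0 + α₂ * z 0 0 * z 1 1) * w 0 1
          + (α₁ * z 0 1 ² + 2ℂ * z 0 0 * z 0 2) * w½½ )
          / (2ˣ *ˣ (zˣ 0 0 *ˣ zˣ 0 0))
        w₀₁²-eq : w 0 1 ² ≈ α₁ * z 0 1 ² + 4ℂ * z 0 0 * z 0 2
        w½½²-eq : w½½ ² ≈
            α₁ * (z 0 0 ² * z 1 1 ² + z 0 1 ² * z 1 0 ²)
          + 2ℂ * α₂ * z 0 0 * z 0 1 * z 1 0 * z 1 1

{-# OPTIONS --safe #-}

-- For the rectangle v + [0,1]×[0,2] put a, a₁ on its left and right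
-- segments and b, b₂ on its lower and upper squares. The System at v says
-- that a², b² are R^{S,1}, R^{C,2} and that the three products ab, ba₁,
-- ab₂ are, up to sign, the corner polynomials R^{B,0}_w; then so is a₁b₂.
-- The quartic equation is equivalent to (R^{B,0}_w)² = R^{S,1} R^{C,2}.
--
-- Prescribing the products of neighbouring segment and square variables
-- prescribes the ratios of neighbouring segment variables, that is, a
-- multiplicative connection on ℤ². It has trivial holonomy around a rectangle
-- by the quartic equation and around a lattice point by the product identity.
-- So it has a potential, fixed by one complex square root. For the converse,
-- multiply the four products around a lattice point.

module Submission where

open import Algebra.Bundles using (AbelianGroup; CommutativeRing; RawRing)
import Algebra.Properties.AbelianGroup as AbelianGroupProperties
import Algebra.Properties.CommutativeSemigroup as CommutativeSemigroupProperties
import Algebra.Properties.Group as GroupProperties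
import Algebra.Solver.Ring as Solver
open import Algebra.Solver.Ring.AlmostCommutativeRing using (fromCommutativeRing; _-Raw-AlmostCommutative⟶_)
open import Data.Integer.Base as ℤ using (ℤ; +_; -[1+_]; +[1+_]; _◃_)
import Data.Integer.Properties as ℤ
open import Data.Maybe.Base using (Maybe; map)
open import Data.Nat.Base as ℕ using (ℕ; zero; suc; s≤s)
import Data.Nat.Coprimality as Coprimality
import Data.Nat.Properties as ℕ
open import Data.Product using (Σ; ∃-syntax; _×_; _,_; proj₁; proj₂; map₂)
open import Data.Rational.Base as ℚ using (ℚ; mkℚ; 0ℚ; 1ℚ; ½)
import Data.Rational.Properties as ℚ
open import Data.Rational.Solver using (module +-*-Solver)
import Data.Rational.Unnormalised.Base as ℚᵘ
import Data.Rational.Unnormalised.Properties as ℚᵘ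
open import Data.Sign.Base as Sign using (Sign)
open import Data.Sum.Base using (_⊎_; inj₁; inj₂)
open import Level using (0ℓ; _⊔_)
import Relation.Binary.Reasoning.Setoid as SetoidReasoning
open import Relation.Binary.PropositionalEquality as ≡ using (_≡_)
open import Relation.Nullary.Decidable.Core using (dec⇒maybe; from-yes)
open import Defs using (ℤ²; _⊕_)

-- Multiplicative potentials

-- The obstacle is a choice of signs. The quartic equation only determines the squares of the corner
-- polynomials, so square roots of `S` and `C` taken point by point would meet the prescribed
-- products of neighbours only up to a sign for each pair. Hence one root is taken, at the origin,
-- and the other values are transported from it; the product identity contributes the sign
-- information that makes the transport consistent.
--
-- Products suffice because each linear equation of `System` becomes polynomial in the values of x
-- after one multiplication: `b` times the equation for `a₁`, or `a` times the one for `b₂`, has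
-- only `a²`, `b²` and `ab` on the right, and the result is a multiple of a corner polynomial with a
-- minus sign. When `a` and `b` are units, the multiplication can be undone.
--
-- Since the reals are Cauchy sequences and the argument is constructive, units carry their
-- inverses, and the square root has to be built without deciding the sign of a real number.

ℤ-induction : ∀ {p} (P : ℤ → Set p) → P (+ 0) →
  (∀ i → P i → P (ℤ.suc i)) → (∀ i → P (ℤ.suc i) → P i) → ∀ i → P i
ℤ-induction P base up down (+ zero)       = base
ℤ-induction P base up down (+ suc n)      = up (+ n) (ℤ-induction P base up down (+ n))
ℤ-induction P base up down -[1+ zero ]    = down -[1+ 0 ] base
ℤ-induction P base up down -[1+ suc n ]   = down -[1+ suc n ] (ℤ-induction P base up down -[1+ n ])

ℤ²-induction : ∀ {p} (P : ℤ → ℤ → Set p) → P (+ 0) (+ 0) →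
  (∀ i j → P i j → P (ℤ.suc i) j) → (∀ i j → P (ℤ.suc i) j → P i j) →
  (∀ i j → P i j → P i (ℤ.suc j)) → (∀ i j → P i (ℤ.suc j) → P i j) → ∀ i j → P i j
ℤ²-induction P base right left up down i =
  ℤ-induction (P i)
    (ℤ-induction (λ i → P i (+ 0)) base (λ i → right i (+ 0)) (λ i → left i (+ 0)) i)
    (up i) (down i)

module Potential {c ℓ} (G : AbelianGroup c ℓ) where
  open AbelianGroup G
  open AbelianGroupProperties G using (∙-cancelˡ; \\-leftDividesˡ)
  open SetoidReasoning setoid

  -- The edge from i to i + 1 carries `r i`. A step towards negative arguments therefore divides by
  -- the ratio indexed by the point it arrives at.
  along : (ℤ → Carrier) → Carrier → ℤ → Carrier
  along r x (+ zero)     = x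
  along r x (+ suc n)    = r (+ n) ∙ along r x (+ n)
  along r x -[1+ zero ]  = r -[1+ 0 ] ⁻¹ ∙ x
  along r x -[1+ suc n ] = r -[1+ suc n ] ⁻¹ ∙ along r x -[1+ n ]

  along-suc : ∀ r x i → along r x (ℤ.suc i) ≈ r i ∙ along r x i
  along-suc r x (+ n)        = refl
  along-suc r x -[1+ zero ]  = sym (\\-leftDividesˡ (r -[1+ 0 ]) x)
  along-suc r x -[1+ suc n ] = sym (\\-leftDividesˡ (r -[1+ suc n ]) (along r x -[1+ n ]))

  potential : (h g : ℤ → ℤ → Carrier) →
    (∀ i j → g (ℤ.suc i) j ∙ h i j ≈ h i (ℤ.suc j) ∙ g i j) → ∀ x →
    ∃[ a ] (a (+ 0) (+ 0) ≈ x
          × (∀ i j → a (ℤ.suc i) j ≈ h i j ∙ a i j)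
          × (∀ i j → a i (ℤ.suc j) ≈ g i j ∙ a i j))
  potential h g flat x = a , refl , horizontal , vertical
    where
    -- Integrating along the horizontal axis and then up each column makes the vertical ratios hold
    -- by construction. The horizontal ones hold on the axis and spread to the other rows by `flat`.
    a : ℤ → ℤ → Carrier
    a i = along (g i) (along (λ k → h k (+ 0)) x i)

    vertical : ∀ i j → a i (ℤ.suc j) ≈ g i j ∙ a i j
    vertical i = along-suc (g i) _

    crossing : ∀ i j → g (ℤ.suc i) j ∙ (h i j ∙ a i j) ≈ h i (ℤ.suc j) ∙ a i (ℤ.suc j)
    crossing i j = begin
      g (ℤ.suc i) j ∙ (h i j ∙ a i j)   ≈⟨ assoc _ _ _ ⟨
      g (ℤ.suc i) j ∙ h i j ∙ a i j     ≈⟨ ∙-congʳ (flat i j) ⟩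
      h i (ℤ.suc j) ∙ g i j ∙ a i j     ≈⟨ assoc _ _ _ ⟩
      h i (ℤ.suc j) ∙ (g i j ∙ a i j)   ≈⟨ ∙-congˡ (vertical i j) ⟨
      h i (ℤ.suc j) ∙ a i (ℤ.suc j)     ∎

    horizontal : ∀ i j → a (ℤ.suc i) j ≈ h i j ∙ a i j
    horizontal i = ℤ-induction _ (along-suc (λ k → h k (+ 0)) x i)
      (λ j eq → begin
        a (ℤ.suc i) (ℤ.suc j)             ≈⟨ vertical (ℤ.suc i) j ⟩
        g (ℤ.suc i) j ∙ a (ℤ.suc i) j     ≈⟨ ∙-congˡ eq ⟩
        g (ℤ.suc i) j ∙ (h i j ∙ a i j)   ≈⟨ crossing i j ⟩
        h i (ℤ.suc j) ∙ a i (ℤ.suc j)     ∎)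
      (λ j eq → ∙-cancelˡ (g (ℤ.suc i) j) _ _ (begin
        g (ℤ.suc i) j ∙ a (ℤ.suc i) j     ≈⟨ vertical (ℤ.suc i) j ⟨
        a (ℤ.suc i) (ℤ.suc j)             ≈⟨ eq ⟩
        h i (ℤ.suc j) ∙ a i (ℤ.suc j)     ≈⟨ crossing i j ⟨
        g (ℤ.suc i) j ∙ (h i j ∙ a i j)   ∎))

-- Units of a commutative ring

module Units {c ℓ} (R : CommutativeRing c ℓ) where
  open CommutativeRing R
  open CommutativeSemigroupProperties *-commutativeSemigroup using (interchange; x∙yz≈y∙xz)
  open SetoidReasoning setoid

  Unit : Carrier → Set (c ⊔ ℓ)
  Unit x = ∃[ y ] x * y ≈ 1#

  unit-* : ∀ {x y} → Unit x → Unit y → Unit (x * y)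
  unit-* {x} {y} (x′ , xx′) (y′ , yy′) = x′ * y′ , (begin
    x * y * (x′ * y′)    ≈⟨ interchange x y x′ y′ ⟩
    x * x′ * (y * y′)    ≈⟨ *-cong xx′ yy′ ⟩
    1# * 1#              ≈⟨ *-identityˡ 1# ⟩
    1#                   ∎)

  unit-resp : ∀ {x y} → x ≈ y → Unit x → Unit y
  unit-resp x≈y (x′ , xx′) = x′ , trans (*-congʳ (sym x≈y)) xx′

  -- Applied to a square, this shows that a square root of a unit is a unit.
  unit-factorˡ : ∀ {x y} → Unit (x * y) → Unit x
  unit-factorˡ {x} {y} (z , eq) = y * z , trans (sym (*-assoc x y z)) eq

  unit-cancelˡ : ∀ {x y z} → Unit x → x * y ≈ x * z → y ≈ z
  unit-cancelˡ {x} {y} {z} (x′ , xx′) eq = begin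
    y              ≈⟨ shrink y ⟨
    x′ * (x * y)   ≈⟨ *-congˡ eq ⟩
    x′ * (x * z)   ≈⟨ shrink z ⟩
    z              ∎
    where
    shrink : ∀ w → x′ * (x * w) ≈ w
    shrink w = begin
      x′ * (x * w)   ≈⟨ *-assoc x′ x w ⟨
      x′ * x * w     ≈⟨ *-congʳ (trans (*-comm x′ x) xx′) ⟩
      1# * w         ≈⟨ *-identityˡ w ⟩
      w              ∎

  fraction-cong : ∀ {a b b′ c d d′} → b * b′ ≈ 1# → d * d′ ≈ 1# → a * d ≈ c * b → a * b′ ≈ c * d′
  fraction-cong {a} {b} {b′} {c} {d} {d′} bb′ dd′ ad≈cb = begin
    a * b′               ≈⟨ *-identityʳ _ ⟨
    a * b′ * 1#          ≈⟨ *-congˡ dd′ ⟨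
    a * b′ * (d * d′)    ≈⟨ interchange a b′ d d′ ⟩
    a * d * (b′ * d′)    ≈⟨ *-congʳ ad≈cb ⟩
    c * b * (b′ * d′)    ≈⟨ *-congˡ (*-comm b′ d′) ⟩
    c * b * (d′ * b′)    ≈⟨ interchange c b d′ b′ ⟩
    c * d′ * (b * b′)    ≈⟨ *-congˡ bb′ ⟩
    c * d′ * 1#          ≈⟨ *-identityʳ _ ⟩
    c * d′               ∎

  fraction-clear : ∀ {x n d d′ y} → d * d′ ≈ 1# → x ≈ (n * d′) * y → d * x ≈ n * y
  fraction-clear {x} {n} {d} {d′} {y} dd′ x≈ = begin
    d * x                ≈⟨ *-congˡ x≈ ⟩
    d * (n * d′ * y)     ≈⟨ *-assoc d (n * d′) y ⟨
    d * (n * d′) * y     ≈⟨ *-congʳ (x∙yz≈y∙xz d n d′) ⟩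
    n * (d * d′) * y     ≈⟨ *-congʳ (trans (*-congˡ dd′) (*-identityʳ n)) ⟩
    n * y                ∎

  inverse-cong : ∀ {x y x′ y′} → x ≈ y → x * x′ ≈ 1# → y * y′ ≈ 1# → x′ ≈ y′
  inverse-cong {y′ = y′} x≈y xx′ yy′ =
    unit-cancelˡ (_ , xx′) (trans xx′ (trans (sym yy′) (*-congʳ (sym x≈y))))

  -- Equality ignores the chosen inverse; inversion still respects it because inverses are unique.
  unitGroup : AbelianGroup (c ⊔ ℓ) ℓ
  unitGroup = record
    { Carrier = Σ Carrier Unit
    ; _≈_ = λ x y → proj₁ x ≈ proj₁ y
    ; _∙_ = λ (x , ux) (y , uy) → x * y , unit-* ux uy
    ; ε = 1# , 1# , *-identityˡ 1#
    ; _⁻¹ = λ (x , x′ , xx′) → x′ , x , trans (*-comm x′ x) xx′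
    ; isAbelianGroup = record
      { isGroup = record
        { isMonoid = record
          { isSemigroup = record
            { isMagma = record
              { isEquivalence = record { refl = refl ; sym = sym ; trans = trans }
              ; ∙-cong = *-cong
              }
            ; assoc = λ (x , _) (y , _) (z , _) → *-assoc x y z
            }
          ; identity = (λ (x , _) → *-identityˡ x) , (λ (x , _) → *-identityʳ x)
          }
        ; inverse = (λ (x , x′ , xx′) → trans (*-comm x′ x) xx′) , (λ (_ , _ , xx′) → xx′)
        ; ⁻¹-cong = λ { {_ , _ , xx′} {_ , _ , yy′} x≈y → inverse-cong x≈y xx′ yy′ }
        }
      ; comm = λ (x , _) (y , _) → *-comm x y
      }
    }

-- Algebra of the lattice equations

⊕-assoc : ∀ u v w → (u ⊕ v) ⊕ w ≡ u ⊕ (v ⊕ w)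
⊕-assoc (a , b) (c , d) (e , f) = ≡.cong₂ _,_ (ℤ.+-assoc a c e) (ℤ.+-assoc b d f)

ℤ-rawRing : RawRing 0ℓ 0ℓ
ℤ-rawRing = CommutativeRing.rawRing ℤ.+-*-commutativeRing

module Lattice {c ℓ} (R : CommutativeRing c ℓ)
  (ι : ℤ-rawRing -Raw-AlmostCommutative⟶ fromCommutativeRing R) where

  open CommutativeRing R
  open _-Raw-AlmostCommutative⟶_ ι using (⟦_⟧)
  open Units R
  open SetoidReasoning setoid

  -- The solver has to compare coefficients, and equality in ℂ is not decidable. Coefficients are
  -- therefore integers, and `α₁`, `α₂` and `κ` are treated as variables.
  _⟦≟⟧_ : ∀ i j → Maybe (⟦ i ⟧ ≈ ⟦ j ⟧)
  i ⟦≟⟧ j = map (λ i≡j → reflexive (≡.cong ⟦_⟧ i≡j)) (dec⇒maybe (i ℤ.≟ j))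

  open Solver ℤ-rawRing (fromCommutativeRing R) ι _⟦≟⟧_
    using (Polynomial; con; _:*_; _:+_; _:-_; :-_; _:=_; solve)

  2# 4# : Carrier
  2# = ⟦ + 2 ⟧
  4# = ⟦ + 4 ⟧

  infix 8 _²
  _² : Carrier → Carrier
  x ² = x * x

  -- For |z| = ρ and z̄ the conjugate, (z + ρ)² = z (z + z̄ + 2ρ), and the
  -- last factor is a nonnegative real.
  sqrt-formula : ∀ {z z̄ ρ σ σ⁻¹} → ρ ² ≈ z * z̄ → σ ² ≈ z + z̄ + (ρ + ρ) → σ * σ⁻¹ ≈ 1# →
    ((z + ρ) * σ⁻¹) ² ≈ z
  sqrt-formula {z} {z̄} {ρ} {σ} {σ⁻¹} ρ² σ² σσ⁻¹ = begin
    ((z + ρ) * σ⁻¹) ²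
      ≈⟨ solve 3 (λ z r s → ((z :+ r) :* s) :* ((z :+ r) :* s) :=
           (z :* z :+ z :* (r :+ r) :+ r :* r) :* (s :* s)) refl z ρ σ⁻¹ ⟩
    (z * z + z * (ρ + ρ) + ρ ²) * σ⁻¹ ²
      ≈⟨ *-congʳ (+-congˡ ρ²) ⟩
    (z * z + z * (ρ + ρ) + z * z̄) * σ⁻¹ ²
      ≈⟨ solve 4 (λ z w r s → (z :* z :+ z :* (r :+ r) :+ z :* w) :* (s :* s) :=
           z :* ((z :+ w :+ (r :+ r)) :* (s :* s))) refl z z̄ ρ σ⁻¹ ⟩
    z * ((z + z̄ + (ρ + ρ)) * σ⁻¹ ²)
      ≈⟨ *-congˡ (*-congʳ σ²) ⟨
    z * (σ ² * σ⁻¹ ²)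
      ≈⟨ solve 3 (λ z s t → z :* ((s :* s) :* (t :* t)) := z :* (s :* t :* (s :* t))) refl z σ σ⁻¹ ⟩
    z * (σ * σ⁻¹ * (σ * σ⁻¹))
      ≈⟨ *-congˡ (trans (*-cong σσ⁻¹ σσ⁻¹) (*-identityˡ 1#)) ⟩
    z * 1#
      ≈⟨ *-identityʳ z ⟩
    z ∎

  -- Polynomials of a rectangle and their identities

  module _ (α₁ α₂ : Carrier) where

    corner : (z₀₀ z₁₀ z₀₁ z₁₁ z₀₂ z₁₂ : Carrier) → Carrier
    corner z₀₀ z₁₀ z₀₁ z₁₁ z₀₂ z₁₂ =
        2# * z₀₀ ² * z₁₂ - α₁ * z₁₀ * z₀₁ ² - 2# * z₀₀ * z₁₀ * z₀₂ - α₂ * z₀₀ * z₀₁ * z₁₁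

    segment : (z₀₀ z₀₁ z₀₂ : Carrier) → Carrier
    segment z₀₀ z₀₁ z₀₂ = α₁ * z₀₁ ² + 4# * z₀₀ * z₀₂

    square : (z₀₀ z₁₀ z₀₁ z₁₁ : Carrier) → Carrier
    square z₀₀ z₁₀ z₀₁ z₁₁ =
      α₁ * (z₀₀ ² * z₁₁ ² + z₀₁ ² * z₁₀ ²) + 2# * α₂ * z₀₀ * z₀₁ * z₁₀ * z₁₁

    -- κ stands for (α₂² - α₁²)/4.
    quartic : (κ z₀₀ z₁₀ z₀₁ z₁₁ z₀₂ z₁₂ : Carrier) → Carrier
    quartic κ z₀₀ z₁₀ z₀₁ z₁₁ z₀₂ z₁₂ =
        z₀₀ ² * z₁₂ ² + z₁₀ ² * z₀₂ ² + κ * z₀₁ ² * z₁₁ ²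
      - α₁ * (z₀₀ * z₀₂ * z₁₁ ² + z₁₀ * z₁₂ * z₀₁ ²)
      - 2# * z₀₀ * z₁₀ * z₀₂ * z₁₂
      - α₂ * (z₀₀ * z₁₂ * z₀₁ * z₁₁ + z₁₀ * z₀₂ * z₀₁ * z₁₁)

    coeffᵃ : (z₀₀ z₁₀ z₀₁ z₁₁ : Carrier) → Carrier
    coeffᵃ z₀₀ z₁₀ z₀₁ z₁₁ = z₀₁ * (α₁ * z₀₁ * z₁₀ + α₂ * z₀₀ * z₁₁)

    coeffᵇ : (z₀₀ z₀₁ z₀₂ : Carrier) → Carrier
    coeffᵇ z₀₀ z₀₁ z₀₂ = α₁ * z₀₁ ² + 2# * z₀₀ * z₀₂

  -- Solver syntax for the same polynomials; the two versions must agree after evaluation.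
  module _ {n : ℕ} (α₁ α₂ : Polynomial n) where

    private
      infix 9 _:²
      _:² : Polynomial n → Polynomial n
      x :² = x :* x
      :2 :4 : Polynomial n
      :2 = con (+ 2)
      :4 = con (+ 4)

    :corner : (z₀₀ z₁₀ z₀₁ z₁₁ z₀₂ z₁₂ : Polynomial n) → Polynomial n
    :corner z₀₀ z₁₀ z₀₁ z₁₁ z₀₂ z₁₂ =
      :2 :* z₀₀ :² :* z₁₂ :- α₁ :* z₁₀ :* z₀₁ :² :- :2 :* z₀₀ :* z₁₀ :* z₀₂ :- α₂ :* z₀₀ :* z₀₁ :* z₁₁

    :segment : (z₀₀ z₀₁ z₀₂ : Polynomial n) → Polynomial n
    :segment z₀₀ z₀₁ z₀₂ = α₁ :* z₀₁ :² :+ :4 :* z₀₀ :* z₀₂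

    :square : (z₀₀ z₁₀ z₀₁ z₁₁ : Polynomial n) → Polynomial n
    :square z₀₀ z₁₀ z₀₁ z₁₁ =
      α₁ :* (z₀₀ :² :* z₁₁ :² :+ z₀₁ :² :* z₁₀ :²) :+ :2 :* α₂ :* z₀₀ :* z₀₁ :* z₁₀ :* z₁₁

    :quartic : (κ z₀₀ z₁₀ z₀₁ z₁₁ z₀₂ z₁₂ : Polynomial n) → Polynomial n
    :quartic κ z₀₀ z₁₀ z₀₁ z₁₁ z₀₂ z₁₂ =
         z₀₀ :² :* z₁₂ :² :+ z₁₀ :² :* z₀₂ :² :+ κ :* z₀₁ :² :* z₁₁ :²
      :- α₁ :* (z₀₀ :* z₀₂ :* z₁₁ :² :+ z₁₀ :* z₁₂ :* z₀₁ :²)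
      :- :2 :* z₀₀ :* z₁₀ :* z₀₂ :* z₁₂
      :- α₂ :* (z₀₀ :* z₁₂ :* z₀₁ :* z₁₁ :+ z₁₀ :* z₀₂ :* z₀₁ :* z₁₁)

    :coeffᵃ : (z₀₀ z₁₀ z₀₁ z₁₁ : Polynomial n) → Polynomial n
    :coeffᵃ z₀₀ z₁₀ z₀₁ z₁₁ = z₀₁ :* (α₁ :* z₀₁ :* z₁₀ :+ α₂ :* z₀₀ :* z₁₁)

    :coeffᵇ : (z₀₀ z₀₁ z₀₂ : Polynomial n) → Polynomial n
    :coeffᵇ z₀₀ z₀₁ z₀₂ = α₁ :* z₀₁ :² :+ :2 :* z₀₀ :* z₀₂

  -- The case κ = (α₂² - α₁²)/4 makes the last bracket vanish.
  corner²-identity : ∀ α₁ α₂ κ z₀₀ z₁₀ z₀₁ z₁₁ z₀₂ z₁₂ →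
    corner α₁ α₂ z₀₀ z₁₀ z₀₁ z₁₁ z₀₂ z₁₂ ² ≈
      segment α₁ α₂ z₀₀ z₀₁ z₀₂ * square α₁ α₂ z₀₀ z₁₀ z₀₁ z₁₁
    + z₀₀ ² * (4# * quartic α₁ α₂ κ z₀₀ z₁₀ z₀₁ z₁₁ z₀₂ z₁₂
             + (α₂ ² - α₁ ² - 4# * κ) * (z₀₁ ² * z₁₁ ²))
  corner²-identity = solve 9 (λ α₁ α₂ κ z₀₀ z₁₀ z₀₁ z₁₁ z₀₂ z₁₂ →
    let r = :corner α₁ α₂ z₀₀ z₁₀ z₀₁ z₁₁ z₀₂ z₁₂ in
    r :* r :=
      :segment α₁ α₂ z₀₀ z₀₁ z₀₂ :* :square α₁ α₂ z₀₀ z₁₀ z₀₁ z₁₁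
    :+ (z₀₀ :* z₀₀) :* (con (+ 4) :* :quartic α₁ α₂ κ z₀₀ z₁₀ z₀₁ z₁₁ z₀₂ z₁₂
             :+ (α₂ :* α₂ :- α₁ :* α₁ :- con (+ 4) :* κ) :* ((z₀₁ :* z₀₁) :* (z₁₁ :* z₁₁)))) refl

  -- Comparison with the first equation of `System`, cleared of its denominator, identifies
  -- `w 0 1 * w½½` with the corner polynomial.
  leading-term : ∀ α₁ α₂ z₀₀ z₁₀ z₀₁ z₁₁ z₀₂ z₁₂ →
    2# * z₀₀ ² * z₁₂ ≈
      α₁ * z₁₀ * z₀₁ ² + 2# * z₀₀ * z₁₀ * z₀₂ + α₂ * z₀₀ * z₀₁ * z₁₁
    + corner α₁ α₂ z₀₀ z₁₀ z₀₁ z₁₁ z₀₂ z₁₂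
  leading-term = solve 8 (λ α₁ α₂ z₀₀ z₁₀ z₀₁ z₁₁ z₀₂ z₁₂ →
    con (+ 2) :* (z₀₀ :* z₀₀) :* z₁₂ :=
       α₁ :* z₁₀ :* (z₀₁ :* z₀₁) :+ con (+ 2) :* z₀₀ :* z₁₀ :* z₀₂ :+ α₂ :* z₀₀ :* z₀₁ :* z₁₁
    :+ :corner α₁ α₂ z₀₀ z₁₀ z₀₁ z₁₁ z₀₂ z₁₂) refl

  -- The left side is `z₁₀ * a + b` times `b`, with `ab` and `b²` replaced by their polynomials. So
  -- `b * a₁` must be minus the corner polynomial at the lower right vertex.
  a-step-identity : ∀ α₁ α₂ z₀₀ z₁₀ z₀₁ z₁₁ z₀₂ z₁₂ →
    z₁₀ * corner α₁ α₂ z₀₀ z₁₀ z₀₁ z₁₁ z₀₂ z₁₂ + square α₁ α₂ z₀₀ z₁₀ z₀₁ z₁₁ ≈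
    z₀₀ * (- corner α₁ α₂ z₁₀ z₀₀ z₁₁ z₀₁ z₁₂ z₀₂)
  a-step-identity = solve 8 (λ α₁ α₂ z₀₀ z₁₀ z₀₁ z₁₁ z₀₂ z₁₂ →
    z₁₀ :* :corner α₁ α₂ z₀₀ z₁₀ z₀₁ z₁₁ z₀₂ z₁₂ :+ :square α₁ α₂ z₀₀ z₁₀ z₀₁ z₁₁ :=
    z₀₀ :* (:- :corner α₁ α₂ z₁₀ z₀₀ z₁₁ z₀₁ z₁₂ z₀₂)) refl

  -- The same for the equation of `b₂`, multiplied by `a`: the product `a * b₂` must be minus the
  -- corner polynomial at the upper left vertex.
  b-step-identity : ∀ α₁ α₂ z₀₀ z₁₀ z₀₁ z₁₁ z₀₂ z₁₂ →
      coeffᵃ α₁ α₂ z₀₀ z₁₀ z₀₁ z₁₁ * segment α₁ α₂ z₀₀ z₀₁ z₀₂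
    + coeffᵇ α₁ α₂ z₀₀ z₀₁ z₀₂ * corner α₁ α₂ z₀₀ z₁₀ z₀₁ z₁₁ z₀₂ z₁₂ ≈
    2# * z₀₀ ² * (- corner α₁ α₂ z₀₂ z₁₂ z₀₁ z₁₁ z₀₀ z₁₀)
  b-step-identity = solve 8 (λ α₁ α₂ z₀₀ z₁₀ z₀₁ z₁₁ z₀₂ z₁₂ →
       :coeffᵃ α₁ α₂ z₀₀ z₁₀ z₀₁ z₁₁ :* :segment α₁ α₂ z₀₀ z₀₁ z₀₂
    :+ :coeffᵇ α₁ α₂ z₀₀ z₀₁ z₀₂ :* :corner α₁ α₂ z₀₀ z₁₀ z₀₁ z₁₁ z₀₂ z₁₂ :=
    con (+ 2) :* (z₀₀ :* z₀₀) :* (:- :corner α₁ α₂ z₀₂ z₁₂ z₀₁ z₁₁ z₀₀ z₁₀)) refl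

  -- The first three summands are the product of the right sides of both step equations, expanded in
  -- `a²`, `b²` and `ab`. Modulo the quartic equation, `a₁ * b₂` becomes the corner polynomial at
  -- the upper right vertex, this time with a plus sign.
  diagonal-identity : ∀ α₁ α₂ κ z₀₀ z₁₀ z₀₁ z₁₁ z₀₂ z₁₂ →
      z₁₀ * coeffᵃ α₁ α₂ z₀₀ z₁₀ z₀₁ z₁₁ * segment α₁ α₂ z₀₀ z₀₁ z₀₂
    + coeffᵇ α₁ α₂ z₀₀ z₀₁ z₀₂ * square α₁ α₂ z₀₀ z₁₀ z₀₁ z₁₁
    + (z₁₀ * coeffᵇ α₁ α₂ z₀₀ z₀₁ z₀₂ + coeffᵃ α₁ α₂ z₀₀ z₁₀ z₀₁ z₁₁)
      * corner α₁ α₂ z₀₀ z₁₀ z₀₁ z₁₁ z₀₂ z₁₂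
    + z₀₀ ² * (4# * quartic α₁ α₂ κ z₀₀ z₁₀ z₀₁ z₁₁ z₀₂ z₁₂
             + (α₂ ² - α₁ ² - 4# * κ) * (z₀₁ ² * z₁₁ ²)) ≈
    2# * z₀₀ ² * z₀₀ * corner α₁ α₂ z₁₂ z₀₂ z₁₁ z₀₁ z₁₀ z₀₀
  diagonal-identity = solve 9 (λ α₁ α₂ κ z₀₀ z₁₀ z₀₁ z₁₁ z₀₂ z₁₂ →
       z₁₀ :* :coeffᵃ α₁ α₂ z₀₀ z₁₀ z₀₁ z₁₁ :* :segment α₁ α₂ z₀₀ z₀₁ z₀₂
    :+ :coeffᵇ α₁ α₂ z₀₀ z₀₁ z₀₂ :* :square α₁ α₂ z₀₀ z₁₀ z₀₁ z₁₁
    :+ (z₁₀ :* :coeffᵇ α₁ α₂ z₀₀ z₀₁ z₀₂ :+ :coeffᵃ α₁ α₂ z₀₀ z₁₀ z₀₁ z₁₁)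
      :* :corner α₁ α₂ z₀₀ z₁₀ z₀₁ z₁₁ z₀₂ z₁₂
    :+ (z₀₀ :* z₀₀) :* (con (+ 4) :* :quartic α₁ α₂ κ z₀₀ z₁₀ z₀₁ z₁₁ z₀₂ z₁₂
             :+ (α₂ :* α₂ :- α₁ :* α₁ :- con (+ 4) :* κ) :* ((z₀₁ :* z₀₁) :* (z₁₁ :* z₁₁))) :=
    con (+ 2) :* (z₀₀ :* z₀₀) :* z₀₀ :* :corner α₁ α₂ z₁₂ z₀₂ z₁₁ z₀₁ z₁₀ z₀₀) refl

  -- The quartic is invariant under the reflections of the rectangle, so `corner²` applies at every
  -- vertex and not only at the lower left one.
  quartic-reflectʰ : ∀ α₁ α₂ κ z₀₀ z₁₀ z₀₁ z₁₁ z₀₂ z₁₂ →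
    quartic α₁ α₂ κ z₁₀ z₀₀ z₁₁ z₀₁ z₁₂ z₀₂ ≈ quartic α₁ α₂ κ z₀₀ z₁₀ z₀₁ z₁₁ z₀₂ z₁₂
  quartic-reflectʰ = solve 9 (λ α₁ α₂ κ z₀₀ z₁₀ z₀₁ z₁₁ z₀₂ z₁₂ →
    :quartic α₁ α₂ κ z₁₀ z₀₀ z₁₁ z₀₁ z₁₂ z₀₂ := :quartic α₁ α₂ κ z₀₀ z₁₀ z₀₁ z₁₁ z₀₂ z₁₂) refl

  quartic-reflectᵛ : ∀ α₁ α₂ κ z₀₀ z₁₀ z₀₁ z₁₁ z₀₂ z₁₂ →
    quartic α₁ α₂ κ z₀₂ z₁₂ z₀₁ z₁₁ z₀₀ z₁₀ ≈ quartic α₁ α₂ κ z₀₀ z₁₀ z₀₁ z₁₁ z₀₂ z₁₂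
  quartic-reflectᵛ = solve 9 (λ α₁ α₂ κ z₀₀ z₁₀ z₀₁ z₁₁ z₀₂ z₁₂ →
    :quartic α₁ α₂ κ z₀₂ z₁₂ z₀₁ z₁₁ z₀₀ z₁₀ := :quartic α₁ α₂ κ z₀₀ z₁₀ z₀₁ z₁₁ z₀₂ z₁₂) refl

  segment-reflect : ∀ α₁ α₂ z₀₀ z₀₁ z₀₂ →
    segment α₁ α₂ z₀₂ z₀₁ z₀₀ ≈ segment α₁ α₂ z₀₀ z₀₁ z₀₂
  segment-reflect = solve 5 (λ α₁ α₂ z₀₀ z₀₁ z₀₂ →
    :segment α₁ α₂ z₀₂ z₀₁ z₀₀ := :segment α₁ α₂ z₀₀ z₀₁ z₀₂) refl

  square-reflectʰ : ∀ α₁ α₂ z₀₀ z₁₀ z₀₁ z₁₁ →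
    square α₁ α₂ z₁₀ z₀₀ z₁₁ z₀₁ ≈ square α₁ α₂ z₀₀ z₁₀ z₀₁ z₁₁
  square-reflectʰ = solve 6 (λ α₁ α₂ z₀₀ z₁₀ z₀₁ z₁₁ →
    :square α₁ α₂ z₁₀ z₀₀ z₁₁ z₀₁ := :square α₁ α₂ z₀₀ z₁₀ z₀₁ z₁₁) refl

  square-reflectᵛ : ∀ α₁ α₂ z₀₀ z₁₀ z₀₁ z₁₁ →
    square α₁ α₂ z₀₁ z₁₁ z₀₀ z₁₀ ≈ square α₁ α₂ z₀₀ z₁₀ z₀₁ z₁₁
  square-reflectᵛ = solve 6 (λ α₁ α₂ z₀₀ z₁₀ z₀₁ z₁₁ →
    :square α₁ α₂ z₀₁ z₁₁ z₀₀ z₁₀ := :square α₁ α₂ z₀₀ z₁₀ z₀₁ z₁₁) refl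

  module Field (α₁ α₂ κ : Carrier) (4κ≈α₂²-α₁² : 4# * κ ≈ α₂ ² - α₁ ²)
    (X : ℤ² → Carrier) (X-unit : ∀ v → Unit (X v))
    (2-unit : Unit 2#) (4-unit : Unit 4#) where

    e₁ e₂ e₁₂ : ℤ²
    e₁  = + 1 , + 0
    e₂  = + 0 , + 1
    e₁₂ = + 1 , + 1

    z : ℤ² → ℕ → ℕ → Carrier
    z v i j = X (v ⊕ (+ i , + j))

    -- Rᵢⱼ v is R^{B,0}_w for B = v + [0,1]×[0,2] and w opposite to v + (i,j).
    R₀₀ R₁₀ R₀₂ R₁₂ S C F : ℤ² → Carrier
    R₀₀ v = corner α₁ α₂ (z v 0 0) (z v 1 0) (z v 0 1) (z v 1 1) (z v 0 2) (z v 1 2)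
    R₁₀ v = corner α₁ α₂ (z v 1 0) (z v 0 0) (z v 1 1) (z v 0 1) (z v 1 2) (z v 0 2)
    R₀₂ v = corner α₁ α₂ (z v 0 2) (z v 1 2) (z v 0 1) (z v 1 1) (z v 0 0) (z v 1 0)
    R₁₂ v = corner α₁ α₂ (z v 1 2) (z v 0 2) (z v 1 1) (z v 0 1) (z v 1 0) (z v 0 0)
    S v = segment α₁ α₂ (z v 0 0) (z v 0 1) (z v 0 2)
    C v = square α₁ α₂ (z v 0 0) (z v 1 0) (z v 0 1) (z v 1 1)
    F v = quartic α₁ α₂ κ (z v 0 0) (z v 1 0) (z v 0 1) (z v 1 1) (z v 0 2) (z v 1 2)

    A B : ℤ² → Carrier
    A v = coeffᵃ α₁ α₂ (z v 0 0) (z v 1 0) (z v 0 1) (z v 1 1)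
    B v = coeffᵇ α₁ α₂ (z v 0 0) (z v 0 1) (z v 0 2)

    S-e₁ : ∀ v → S (v ⊕ e₁) ≡ segment α₁ α₂ (z v 1 0) (z v 1 1) (z v 1 2)
    S-e₁ v rewrite ⊕-assoc v e₁ (+ 0 , + 0) | ⊕-assoc v e₁ (+ 0 , + 1)
      | ⊕-assoc v e₁ (+ 0 , + 2) = ≡.refl

    C-e₂ : ∀ v → C (v ⊕ e₂) ≡ square α₁ α₂ (z v 0 1) (z v 1 1) (z v 0 2) (z v 1 2)
    C-e₂ v rewrite ⊕-assoc v e₂ (+ 0 , + 0) | ⊕-assoc v e₂ (+ 1 , + 0)
      | ⊕-assoc v e₂ (+ 0 , + 1) | ⊕-assoc v e₂ (+ 1 , + 1) = ≡.refl

    -- The polynomial identities have integer coefficients and cannot contain a quarter; here the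
    -- variable `κ` receives its value.
    4quartic+defect : ∀ q y → 4# * q + (α₂ ² - α₁ ² - 4# * κ) * y ≈ 4# * q
    4quartic+defect q y = begin
      4# * q + (α₂ ² - α₁ ² - 4# * κ) * y        ≈⟨ +-congˡ (*-congʳ (+-congˡ (-‿cong 4κ≈α₂²-α₁²))) ⟩
      4# * q + (α₂ ² - α₁ ² - (α₂ ² - α₁ ²)) * y ≈⟨ +-congˡ (*-congʳ (-‿inverseʳ _)) ⟩
      4# * q + 0# * y                            ≈⟨ +-congˡ (zeroˡ y) ⟩
      4# * q + 0#                                ≈⟨ +-identityʳ _ ⟩
      4# * q                                     ∎

    +-vanishing : ∀ {q} → q ≈ 0# → ∀ x w y →
      x + w * (4# * q + (α₂ ² - α₁ ² - 4# * κ) * y) ≈ x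
    +-vanishing {q} q≈0 x w y = begin
      x + w * (4# * q + (α₂ ² - α₁ ² - 4# * κ) * y) ≈⟨ +-congˡ (*-congˡ (4quartic+defect q y)) ⟩
      x + w * (4# * q)                              ≈⟨ +-congˡ (*-congˡ (trans (*-congˡ q≈0) (zeroʳ 4#))) ⟩
      x + w * 0#                                    ≈⟨ +-congˡ (zeroʳ w) ⟩
      x + 0#                                        ≈⟨ +-identityʳ x ⟩
      x                                             ∎

    corner² : ∀ z₀₀ z₁₀ z₀₁ z₁₁ z₀₂ z₁₂ → quartic α₁ α₂ κ z₀₀ z₁₀ z₀₁ z₁₁ z₀₂ z₁₂ ≈ 0# →
      corner α₁ α₂ z₀₀ z₁₀ z₀₁ z₁₁ z₀₂ z₁₂ ² ≈
      segment α₁ α₂ z₀₀ z₀₁ z₀₂ * square α₁ α₂ z₀₀ z₁₀ z₀₁ z₁₁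
    corner² z₀₀ z₁₀ z₀₁ z₁₁ z₀₂ z₁₂ q≈0 =
      trans (corner²-identity α₁ α₂ κ z₀₀ z₁₀ z₀₁ z₁₁ z₀₂ z₁₂) (+-vanishing q≈0 _ _ _)

    2z³-unit : ∀ v → Unit (2# * z v 0 0 ² * z v 0 0)
    2z³-unit v = unit-* (unit-* 2-unit (unit-* (X-unit _) (X-unit _))) (X-unit _)

    diagonal : ∀ v → F v ≈ 0# →
      z v 1 0 * A v * S v + B v * C v + (z v 1 0 * B v + A v) * R₀₀ v ≈
      2# * z v 0 0 ² * z v 0 0 * R₁₂ v
    diagonal v Fv≈0 = trans (sym (+-vanishing Fv≈0 _ _ _))
      (diagonal-identity α₁ α₂ κ (z v 0 0) (z v 1 0) (z v 0 1) (z v 1 1) (z v 0 2) (z v 1 2))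

    -- a and b sit on the left segment and the lower square of the rectangle
    -- v + [0,1]×[0,2], a₁ and b₂ on the right segment and the upper square.
    record Solves (v : ℤ²) (a b a₁ b₂ : Carrier) : Set ℓ where
      field
        ab-eq  : a * b ≈ R₀₀ v
        a-step : z v 0 0 * a₁ ≈ z v 1 0 * a + b
        b-step : 2# * z v 0 0 ² * b₂ ≈ A v * a + B v * b
        a²-eq  : a ² ≈ S v
        b²-eq  : b ² ≈ C v

    Solution : (a b : ℤ² → Carrier) → Set ℓ
    Solution a b = ∀ v → Solves v (a v) (b v) (a (v ⊕ e₁)) (b (v ⊕ e₂))

    -- The product identity at the lattice point `v ⊕ e₁₂`, with every factor read from the lower
    -- left vertex of its rectangle. This centre keeps all offsets nonnegative: the four rectangles
    -- around it start at `v ⊕ e₁₂`, `v ⊕ e₂`, `v` and `v ⊕ e₁`.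
    CornerProduct : ℤ² → Set ℓ
    CornerProduct v =
      R₀₀ (v ⊕ e₁₂) * R₁₀ (v ⊕ e₂) * R₁₂ v * R₀₂ (v ⊕ e₁) ≈
      S (v ⊕ e₁₂) * S (v ⊕ e₁) * C (v ⊕ e₁₂) * C (v ⊕ e₂)

    ⊕-e₁e₂ : ∀ v → (v ⊕ e₁) ⊕ e₂ ≡ v ⊕ e₁₂
    ⊕-e₁e₂ v = ⊕-assoc v e₁ e₂

    ⊕-e₂e₁ : ∀ v → (v ⊕ e₂) ⊕ e₁ ≡ v ⊕ e₁₂
    ⊕-e₂e₁ v = ⊕-assoc v e₂ e₁

    -- From the quartic equation and the product identity to a solution

    module Existence (F≈0 : ∀ v → F v ≈ 0#) (product : ∀ v → CornerProduct v)
      (S-unit : ∀ v → Unit (S v)) (C-unit : ∀ v → Unit (C v)) where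

      R₀₀² : ∀ v → R₀₀ v ² ≈ S v * C v
      R₀₀² v = corner² (z v 0 0) (z v 1 0) (z v 0 1) (z v 1 1) (z v 0 2) (z v 1 2) (F≈0 v)

      R₁₀² : ∀ v → R₁₀ v ² ≈ S (v ⊕ e₁) * C v
      R₁₀² v = trans
        (corner² _ _ _ _ _ _ (trans (quartic-reflectʰ _ _ _ _ _ _ _ _ _) (F≈0 v)))
        (*-cong (reflexive (≡.sym (S-e₁ v))) (square-reflectʰ _ _ _ _ _ _))

      R₀₂² : ∀ v → R₀₂ v ² ≈ S v * C (v ⊕ e₂)
      R₀₂² v = trans
        (corner² _ _ _ _ _ _ (trans (quartic-reflectᵛ _ _ _ _ _ _ _ _ _) (F≈0 v)))
        (*-cong (segment-reflect α₁ α₂ _ _ _)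
          (trans (square-reflectᵛ _ _ _ _ _ _) (reflexive (≡.sym (C-e₂ v)))))

      unit-root : ∀ {x s c} → x ² ≈ s * c → Unit s → Unit c → Unit x
      unit-root eq us uc = unit-factorˡ (unit-resp (sym eq) (unit-* us uc))

      R₀₀-unit : ∀ v → Unit (R₀₀ v)
      R₀₀-unit v = unit-root (R₀₀² v) (S-unit v) (C-unit v)

      R₁₀-unit : ∀ v → Unit (R₁₀ v)
      R₁₀-unit v = unit-root (R₁₀² v) (S-unit (v ⊕ e₁)) (C-unit v)

      R₀₂-unit : ∀ v → Unit (R₀₂ v)
      R₀₂-unit v = unit-root (R₀₂² v) (S-unit v) (C-unit (v ⊕ e₂))

      -- Both sides stand for the product of `a`, `b`, `a₁` and `b₂`, grouped in two ways. Before
      -- these exist, the relation is found by multiplying `diagonal` by `R₀₀ v` and factoring.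
      around-rectangle : ∀ v → R₀₀ v * R₁₂ v ≈ R₁₀ v * R₀₂ v
      around-rectangle v = unit-cancelˡ (2z³-unit v) (begin
        2# * z v 0 0 ² * z v 0 0 * (R₀₀ v * R₁₂ v)
          ≈⟨ solve 4 (λ d y p u → d :* y :* (p :* u) := p :* (d :* y :* u)) refl
               (2# * z v 0 0 ²) (z v 0 0) (R₀₀ v) (R₁₂ v) ⟩
        R₀₀ v * (2# * z v 0 0 ² * z v 0 0 * R₁₂ v)
          ≈⟨ *-congˡ (diagonal v (F≈0 v)) ⟨
        R₀₀ v * (z v 1 0 * A v * S v + B v * C v + (z v 1 0 * B v + A v) * R₀₀ v)
          ≈⟨ solve 6 (λ p y a b s c → p :* (y :* a :* s :+ b :* c :+ (y :* b :+ a) :* p)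
               := (y :* a :* s :* p :+ b :* c :* p :+ y :* b :* (p :* p)) :+ a :* (p :* p)) refl
               (R₀₀ v) (z v 1 0) (A v) (B v) (S v) (C v) ⟩
        (z v 1 0 * A v * S v * R₀₀ v + B v * C v * R₀₀ v + z v 1 0 * B v * R₀₀ v ²) + A v * R₀₀ v ²
          -- Only the square next to `A v` is replaced; with the other one kept, the sum splits into
          -- the left sides of the two step identities.
          ≈⟨ +-congˡ (*-congˡ (R₀₀² v)) ⟩
        (z v 1 0 * A v * S v * R₀₀ v + B v * C v * R₀₀ v + z v 1 0 * B v * R₀₀ v ²) + A v * (S v * C v)
          ≈⟨ solve 6 (λ p y a b s c →
               (y :* a :* s :* p :+ b :* c :* p :+ y :* b :* (p :* p)) :+ a :* (s :* c)
               := (y :* p :+ c) :* (a :* s :+ b :* p)) refl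
               (R₀₀ v) (z v 1 0) (A v) (B v) (S v) (C v) ⟩
        (z v 1 0 * R₀₀ v + C v) * (A v * S v + B v * R₀₀ v)
          ≈⟨ *-cong (a-step-identity _ _ _ _ _ _ _ _) (b-step-identity _ _ _ _ _ _ _ _) ⟩
        z v 0 0 * (- R₁₀ v) * (2# * z v 0 0 ² * (- R₀₂ v))
          ≈⟨ solve 4 (λ d y p u → y :* (:- p) :* (d :* (:- u)) := d :* y :* (p :* u)) refl
               (2# * z v 0 0 ²) (z v 0 0) (R₁₀ v) (R₀₂ v) ⟩
        2# * z v 0 0 ² * z v 0 0 * (R₁₀ v * R₀₂ v) ∎)

      -- By `R₁₀²` and `R₀₂²`, the right side of the product identity is the square of
      -- `R₁₀ (v ⊕ e₂) * R₀₂ (v ⊕ e₁)`, and one copy of this unit cancels.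
      around-point : ∀ v → R₀₀ (v ⊕ e₁₂) * R₁₂ v ≈ R₁₀ (v ⊕ e₂) * R₀₂ (v ⊕ e₁)
      around-point v = unit-cancelˡ (unit-* (R₁₀-unit (v ⊕ e₂)) (R₀₂-unit (v ⊕ e₁))) (begin
        q * t * (p * u)
          ≈⟨ solve 4 (λ p q t u → q :* t :* (p :* u) := p :* q :* u :* t) refl p q t u ⟩
        p * q * u * t
          ≈⟨ product v ⟩
        S (v ⊕ e₁₂) * S (v ⊕ e₁) * C (v ⊕ e₁₂) * C (v ⊕ e₂)
          ≈⟨ solve 4 (λ s s′ c c′ → s :* s′ :* c :* c′ := (s :* c′) :* (s′ :* c)) refl _ _ _ _ ⟩
        (S (v ⊕ e₁₂) * C (v ⊕ e₂)) * (S (v ⊕ e₁) * C (v ⊕ e₁₂))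
          ≈⟨ *-cong (*-congʳ (reflexive (≡.cong S (⊕-e₂e₁ v)))) (*-congˡ (reflexive (≡.cong C (⊕-e₁e₂ v)))) ⟨
        (S (v ⊕ e₂ ⊕ e₁) * C (v ⊕ e₂)) * (S (v ⊕ e₁) * C (v ⊕ e₁ ⊕ e₂))
          ≈⟨ *-cong (R₁₀² (v ⊕ e₂)) (R₀₂² (v ⊕ e₁)) ⟨
        q ² * t ²
          ≈⟨ solve 2 (λ q t → (q :* q) :* (t :* t) := q :* t :* (q :* t)) refl q t ⟩
        q * t * (q * t) ∎)
        where
        p q t u : Carrier
        p = R₀₀ (v ⊕ e₁₂)
        q = R₁₀ (v ⊕ e₂)
        t = R₀₂ (v ⊕ e₁)
        u = R₁₂ v

      Edge₁ Edge₂ : ℤ² → Carrier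
      Edge₁ v = - R₁₀ v
      Edge₂ v = - R₀₂ v

      -‿² : ∀ x → (- x) ² ≈ x ²
      -‿² = solve 1 (λ x → (:- x) :* (:- x) := x :* x) refl

      -‿unit : ∀ {x} → Unit x → Unit (- x)
      -‿unit {x} (y , xy) = - y , trans (solve 2 (λ x y → (:- x) :* (:- y) := x :* y) refl x y) xy

      -- The ratios of `a` at `v ⊕ e₁` and at `v ⊕ e₂` to `a v`. In each case both segments adjoin a
      -- common square, `C v` or `C (v ⊕ e₂)`, and its variable drops out of the quotient of the two
      -- prescribed products.
      h g : ℤ² → Σ Carrier Unit
      h v = let r = R₀₀-unit v in
        Edge₁ v * proj₁ r , unit-* (-‿unit (R₁₀-unit v)) (R₀₀ v , trans (*-comm _ _) (proj₂ r))
      g v = let t = -‿unit (R₀₂-unit v) in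
        R₀₀ (v ⊕ e₂) * proj₁ t , unit-* (R₀₀-unit (v ⊕ e₂)) (Edge₂ v , trans (*-comm _ _) (proj₂ t))

      -- A closed loop of four segments combines one rectangle with one lattice point: `cross`
      -- applies `around-rectangle` at `v` and then `around-point`.
      h-g-flat : ∀ v → proj₁ (g (v ⊕ e₁)) * proj₁ (h v) ≈ proj₁ (h (v ⊕ e₂)) * proj₁ (g v)
      h-g-flat v = begin
        R₀₀ (v ⊕ e₁ ⊕ e₂) * t₁⁻¹ * (Edge₁ v * p⁻¹)
          ≈⟨ *-congʳ (*-congʳ (reflexive (≡.cong R₀₀ (⊕-e₁e₂ v)))) ⟩
        R₀₀ (v ⊕ e₁₂) * t₁⁻¹ * (Edge₁ v * p⁻¹)
          ≈⟨ solve 4 (λ a b c d → a :* b :* (c :* d) := (a :* c) :* (b :* d)) refl _ _ _ _ ⟩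
        R₀₀ (v ⊕ e₁₂) * Edge₁ v * (t₁⁻¹ * p⁻¹)
          ≈⟨ fraction-cong (proj₂ (unit-* (-‿unit (R₀₂-unit (v ⊕ e₁))) (R₀₀-unit v)))
               (proj₂ (-‿unit (R₀₂-unit v))) cross ⟩
        Edge₁ (v ⊕ e₂) * t⁻¹
          -- `R₀₀ (v ⊕ e₂)` is the denominator of `h (v ⊕ e₂)` and the numerator of `g v`, so it is
          -- absent from `cross` and is reinserted here.
          ≈⟨ *-congʳ (trans (*-congˡ (proj₂ (R₀₀-unit (v ⊕ e₂)))) (*-identityʳ _)) ⟨
        Edge₁ (v ⊕ e₂) * (R₀₀ (v ⊕ e₂) * p₂⁻¹) * t⁻¹
          ≈⟨ solve 4 (λ a b c d → a :* (b :* c) :* d := a :* c :* (b :* d)) refl _ _ _ _ ⟩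
        Edge₁ (v ⊕ e₂) * p₂⁻¹ * (R₀₀ (v ⊕ e₂) * t⁻¹) ∎
        where
        p⁻¹ t⁻¹ p₂⁻¹ t₁⁻¹ : Carrier
        p⁻¹  = proj₁ (R₀₀-unit v)
        t⁻¹  = proj₁ (-‿unit (R₀₂-unit v))
        p₂⁻¹ = proj₁ (R₀₀-unit (v ⊕ e₂))
        t₁⁻¹ = proj₁ (-‿unit (R₀₂-unit (v ⊕ e₁)))

        cross : R₀₀ (v ⊕ e₁₂) * Edge₁ v * Edge₂ v ≈ Edge₁ (v ⊕ e₂) * (Edge₂ (v ⊕ e₁) * R₀₀ v)
        cross = begin
          R₀₀ (v ⊕ e₁₂) * Edge₁ v * Edge₂ v
            ≈⟨ solve 3 (λ p q t → p :* (:- q) :* (:- t) := p :* (q :* t)) refl _ _ _ ⟩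
          R₀₀ (v ⊕ e₁₂) * (R₁₀ v * R₀₂ v)
            ≈⟨ *-congˡ (around-rectangle v) ⟨
          R₀₀ (v ⊕ e₁₂) * (R₀₀ v * R₁₂ v)
            ≈⟨ solve 3 (λ p q t → p :* (q :* t) := p :* t :* q) refl _ _ _ ⟩
          R₀₀ (v ⊕ e₁₂) * R₁₂ v * R₀₀ v
            ≈⟨ *-congʳ (around-point v) ⟩
          R₁₀ (v ⊕ e₂) * R₀₂ (v ⊕ e₁) * R₀₀ v
            ≈⟨ solve 3 (λ q t p → q :* t :* p := (:- q) :* ((:- t) :* p)) refl _ _ _ ⟩
          Edge₁ (v ⊕ e₂) * (Edge₂ (v ⊕ e₁) * R₀₀ v) ∎

      -- Squaring a ratio of two corner polynomials that share the square `c` leaves the ratio of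
      -- their segments. Thus `a²` changes along an edge by the same factor as `S`.
      ratio² : ∀ {x y r s a a′ c} → Unit c → x ² ≈ r * c → y ² ≈ s * c → x * a′ ≈ y * a →
               a′ ² * r ≈ a ² * s
      ratio² {x} {y} {r} {s} {a} {a′} {c} c-unit x² y² xa′≈ya = unit-cancelˡ c-unit (begin
        c * (a′ ² * r)         ≈⟨ solve 3 (λ c a r → c :* ((a :* a) :* r) := (r :* c) :* (a :* a)) refl c a′ r ⟩
        (r * c) * a′ ²         ≈⟨ *-congʳ x² ⟨
        x ² * a′ ²             ≈⟨ solve 2 (λ x a → (x :* x) :* (a :* a) := (x :* a) :* (x :* a)) refl x a′ ⟩
        (x * a′) * (x * a′)    ≈⟨ *-cong xa′≈ya xa′≈ya ⟩
        (y * a) * (y * a)      ≈⟨ solve 2 (λ x a → (x :* x) :* (a :* a) := (x :* a) :* (x :* a)) refl y a ⟨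
        y ² * a ²              ≈⟨ *-congʳ y² ⟩
        (s * c) * a ²          ≈⟨ solve 3 (λ c a r → c :* ((a :* a) :* r) := (r :* c) :* (a :* a)) refl c a s ⟨
        c * (a ² * s)          ∎)

      cross-solve : ∀ {x y s t} → Unit t → x * t ≈ y * s → y ≈ t → x ≈ s
      cross-solve t-unit xt≈ys y≈t =
        unit-cancelˡ t-unit (trans (*-comm _ _) (trans xt≈ys (*-congʳ y≈t)))

      ⊕-e₁ : ∀ i j → (i , j) ⊕ e₁ ≡ (ℤ.suc i , j)
      ⊕-e₁ i j = ≡.cong₂ _,_ (ℤ.+-comm i (+ 1)) (ℤ.+-identityʳ j)

      ⊕-e₂ : ∀ i j → (i , j) ⊕ e₂ ≡ (i , ℤ.suc j)
      ⊕-e₂ i j = ≡.cong₂ _,_ (ℤ.+-identityʳ i) (ℤ.+-comm j (+ 1))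

      solution : ∃[ r ] r ² ≈ S (+ 0 , + 0) → ∃[ a ] ∃[ b ] Solution a b
      solution (r , r²) = a , b , solves
        where
        flat : ∀ i j → proj₁ (g (ℤ.suc i , j)) * proj₁ (h (i , j)) ≈ proj₁ (h (i , ℤ.suc j)) * proj₁ (g (i , j))
        flat i j = ≡.subst₂ (λ u w → proj₁ (g u) * proj₁ (h (i , j)) ≈ proj₁ (h w) * proj₁ (g (i , j)))
          (⊕-e₁ i j) (⊕-e₂ i j) (h-g-flat (i , j))

        r-unit : Unit r
        r-unit = unit-factorˡ (unit-resp (sym r²) (S-unit (+ 0 , + 0)))

        pot = Potential.potential unitGroup (λ i j → h (i , j)) (λ i j → g (i , j)) flat (r , r-unit)

        a b : ℤ² → Carrier
        a (i , j) = proj₁ (proj₁ pot i j)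

        a-unit : ∀ v → Unit (a v)
        a-unit (i , j) = proj₂ (proj₁ pot i j)

        -- With `b` defined as `R₀₀` divided by `a`, the prescribed `ab` holds outright, and `b²`
        -- follows from `R₀₀²` on cancelling `S`.
        b v = R₀₀ v * proj₁ (a-unit v)

        a-e₁ : ∀ v → R₀₀ v * a (v ⊕ e₁) ≈ Edge₁ v * a v
        a-e₁ v@(i , j) = fraction-clear (proj₂ (R₀₀-unit v))
          (trans (reflexive (≡.cong a (⊕-e₁ i j))) (proj₁ (proj₂ (proj₂ pot)) i j))

        a-e₂ : ∀ v → Edge₂ v * a (v ⊕ e₂) ≈ R₀₀ (v ⊕ e₂) * a v
        a-e₂ v@(i , j) = fraction-clear (proj₂ (-‿unit (R₀₂-unit v)))
          (trans (reflexive (≡.cong a (⊕-e₂ i j))) (proj₂ (proj₂ (proj₂ pot)) i j))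

        a²-e₁ : ∀ v → a (v ⊕ e₁) ² * S v ≈ a v ² * S (v ⊕ e₁)
        a²-e₁ v = ratio² (C-unit v) (R₀₀² v) (trans (-‿² _) (R₁₀² v)) (a-e₁ v)

        a²-e₂ : ∀ v → a (v ⊕ e₂) ² * S v ≈ a v ² * S (v ⊕ e₂)
        a²-e₂ v = ratio² (C-unit (v ⊕ e₂)) (trans (-‿² _) (R₀₂² v)) (R₀₀² (v ⊕ e₂)) (a-e₂ v)

        -- The root `r` gives the case of the origin. As `S` is a unit everywhere, the relations
        -- along edges carry it both forwards and backwards.
        a² : ∀ v → a v ² ≈ S v
        a² (i , j) = ℤ²-induction (λ i j → a (i , j) ² ≈ S (i , j))
          (trans (*-cong (proj₁ (proj₂ pot)) (proj₁ (proj₂ pot))) r²)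
          (λ i j eq → ≡.subst (λ u → a u ² ≈ S u) (⊕-e₁ i j)
            (cross-solve (S-unit (i , j)) (a²-e₁ (i , j)) eq))
          (λ i j eq → cross-solve (S-unit ((i , j) ⊕ e₁)) (sym (a²-e₁ (i , j)))
            (≡.subst (λ u → a u ² ≈ S u) (≡.sym (⊕-e₁ i j)) eq))
          (λ i j eq → ≡.subst (λ u → a u ² ≈ S u) (⊕-e₂ i j)
            (cross-solve (S-unit (i , j)) (a²-e₂ (i , j)) eq))
          (λ i j eq → cross-solve (S-unit ((i , j) ⊕ e₂)) (sym (a²-e₂ (i , j)))
            (≡.subst (λ u → a u ² ≈ S u) (≡.sym (⊕-e₂ i j)) eq))
          i j

        ab : ∀ v → a v * b v ≈ R₀₀ v
        ab v = trans (fraction-clear (proj₂ (a-unit v)) (sym (*-identityʳ _))) (*-identityʳ _)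

        b² : ∀ v → b v ² ≈ C v
        b² v = unit-cancelˡ (S-unit v) (begin
          S v * b v ²              ≈⟨ *-congʳ (a² v) ⟨
          a v ² * b v ²            ≈⟨ solve 2 (λ x a → (x :* x) :* (a :* a) := (x :* a) :* (x :* a)) refl _ _ ⟩
          (a v * b v) ²            ≈⟨ *-cong (ab v) (ab v) ⟩
          R₀₀ v ²                  ≈⟨ R₀₀² v ⟩
          S v * C v                ∎)

        b-unit : ∀ v → Unit (b v)
        b-unit v = unit-factorˡ (unit-resp (sym (b² v)) (C-unit v))

        ba-e₁ : ∀ v → b v * a (v ⊕ e₁) ≈ Edge₁ v
        ba-e₁ v = unit-cancelˡ (a-unit v) (begin
          a v * (b v * a (v ⊕ e₁))     ≈⟨ *-assoc _ _ _ ⟨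
          a v * b v * a (v ⊕ e₁)       ≈⟨ *-congʳ (ab v) ⟩
          R₀₀ v * a (v ⊕ e₁)           ≈⟨ a-e₁ v ⟩
          Edge₁ v * a v                ≈⟨ *-comm _ _ ⟩
          a v * Edge₁ v                ∎)

        ab-e₂ : ∀ v → a v * b (v ⊕ e₂) ≈ Edge₂ v
        ab-e₂ v = unit-cancelˡ (a-unit (v ⊕ e₂)) (begin
          a (v ⊕ e₂) * (a v * b (v ⊕ e₂))   ≈⟨ solve 3 (λ x y z → x :* (y :* z) := (x :* z) :* y) refl _ _ _ ⟩
          a (v ⊕ e₂) * b (v ⊕ e₂) * a v     ≈⟨ *-congʳ (ab (v ⊕ e₂)) ⟩
          R₀₀ (v ⊕ e₂) * a v                ≈⟨ a-e₂ v ⟨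
          Edge₂ v * a (v ⊕ e₂)              ≈⟨ *-comm _ _ ⟩
          a (v ⊕ e₂) * Edge₂ v              ∎)

        solves : Solution a b
        solves v = record
          { ab-eq = ab v
          -- After multiplication by the unit `b v`, both sides consist of prescribed products,
          -- which `a-step-identity` compares; `b-step` does the same with `a v`.
          ; a-step = unit-cancelˡ (b-unit v) (begin
              b v * (z v 0 0 * a (v ⊕ e₁))
                ≈⟨ solve 3 (λ x y z → x :* (y :* z) := y :* (x :* z)) refl _ _ _ ⟩
              z v 0 0 * (b v * a (v ⊕ e₁))     ≈⟨ *-congˡ (ba-e₁ v) ⟩
              z v 0 0 * Edge₁ v                ≈⟨ a-step-identity _ _ _ _ _ _ _ _ ⟨
              z v 1 0 * R₀₀ v + C v            ≈⟨ +-cong (*-congˡ (ab v)) (b² v) ⟨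
              z v 1 0 * (a v * b v) + b v ²
                ≈⟨ solve 3 (λ y a b → y :* (a :* b) :+ (b :* b) := b :* (y :* a :+ b)) refl _ _ _ ⟩
              b v * (z v 1 0 * a v + b v)      ∎)
          ; b-step = unit-cancelˡ (a-unit v) (begin
              a v * (2# * z v 0 0 ² * b (v ⊕ e₂))
                ≈⟨ solve 3 (λ x y z → x :* (y :* z) := y :* (x :* z)) refl _ _ _ ⟩
              2# * z v 0 0 ² * (a v * b (v ⊕ e₂))   ≈⟨ *-congˡ (ab-e₂ v) ⟩
              2# * z v 0 0 ² * Edge₂ v              ≈⟨ b-step-identity _ _ _ _ _ _ _ _ ⟨
              A v * S v + B v * R₀₀ v               ≈⟨ +-cong (*-congˡ (a² v)) (*-congˡ (ab v)) ⟨
              A v * a v ² + B v * (a v * b v)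
                ≈⟨ solve 4 (λ c d a b → c :* (a :* a) :+ d :* (a :* b)
                     := a :* (c :* a :+ d :* b)) refl _ _ _ _ ⟩
              a v * (A v * a v + B v * b v)         ∎)
          ; a²-eq = a² v
          ; b²-eq = b² v
          }

    -- From a solution to the quartic equation and the product identity

    module Converse (a b : ℤ² → Carrier) (solves : Solution a b) where
      open module Sol (v : ℤ²) = Solves (solves v)

      F≈0 : ∀ v → F v ≈ 0#
      F≈0 v = unit-cancelˡ (unit-* (unit-* (X-unit _) (X-unit _)) 4-unit) (begin
        z v 0 0 ² * 4# * F v      ≈⟨ *-assoc _ _ _ ⟩
        z v 0 0 ² * (4# * F v)    ≈⟨ *-congˡ (4quartic+defect _ _) ⟨
        _
          -- The term left implicit is the correction in `corner²-identity`. The square of `R₀₀ v`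
          -- already equals `S v * C v`, so the correction is zero.
          ≈⟨ +-cancelˡ _ _ _ (trans (sym (corner²-identity α₁ α₂ κ
               (z v 0 0) (z v 1 0) (z v 0 1) (z v 1 1) (z v 0 2) (z v 1 2))) R₀₀²) ⟩
        0#                        ≈⟨ zeroʳ _ ⟨
        z v 0 0 ² * 4# * 0#       ∎)
        where
        open GroupProperties +-group using () renaming (∙-cancelˡ to +-cancelˡ)
        R₀₀² : R₀₀ v ² ≈ S v * C v + 0#
        R₀₀² = begin
          R₀₀ v ²               ≈⟨ *-cong (ab-eq v) (ab-eq v) ⟨
          (a v * b v) ²         ≈⟨ solve 2 (λ x a → (x :* x) :* (a :* a) := (x :* a) :* (x :* a)) refl _ _ ⟨
          a v ² * b v ²         ≈⟨ *-cong (a²-eq v) (b²-eq v) ⟩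
          S v * C v             ≈⟨ +-identityʳ _ ⟨
          S v * C v + 0#        ∎

      ba-e₁ : ∀ v → b v * a (v ⊕ e₁) ≈ - R₁₀ v
      ba-e₁ v = unit-cancelˡ (X-unit _) (begin
        z v 0 0 * (b v * a (v ⊕ e₁))     ≈⟨ solve 3 (λ x y z → y :* (x :* z) := x :* (y :* z)) refl _ _ _ ⟩
        b v * (z v 0 0 * a (v ⊕ e₁))     ≈⟨ *-congˡ (a-step v) ⟩
        b v * (z v 1 0 * a v + b v)
          ≈⟨ solve 3 (λ y a b → y :* (a :* b) :+ (b :* b) := b :* (y :* a :+ b)) refl _ _ _ ⟨
        z v 1 0 * (a v * b v) + b v ²    ≈⟨ +-cong (*-congˡ (ab-eq v)) (b²-eq v) ⟩
        z v 1 0 * R₀₀ v + C v            ≈⟨ a-step-identity _ _ _ _ _ _ _ _ ⟩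
        z v 0 0 * (- R₁₀ v)              ∎)

      ab-e₂ : ∀ v → a v * b (v ⊕ e₂) ≈ - R₀₂ v
      ab-e₂ v = unit-cancelˡ (unit-* 2-unit (unit-* (X-unit _) (X-unit _))) (begin
        2# * z v 0 0 ² * (a v * b (v ⊕ e₂))   ≈⟨ solve 3 (λ x y z → y :* (x :* z) := x :* (y :* z)) refl _ _ _ ⟩
        a v * (2# * z v 0 0 ² * b (v ⊕ e₂))   ≈⟨ *-congˡ (b-step v) ⟩
        a v * (A v * a v + B v * b v)
          ≈⟨ solve 4 (λ c d a b → c :* (a :* a) :+ d :* (a :* b) := a :* (c :* a :+ d :* b)) refl _ _ _ _ ⟨
        A v * a v ² + B v * (a v * b v)       ≈⟨ +-cong (*-congˡ (a²-eq v)) (*-congˡ (ab-eq v)) ⟩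
        A v * S v + B v * R₀₀ v               ≈⟨ b-step-identity _ _ _ _ _ _ _ _ ⟩
        2# * z v 0 0 ² * (- R₀₂ v)            ∎)

      -- In this direction `a` and `b` may vanish, so the two step equations are multiplied together
      -- and only a multiple of a power of `z v 0 0` is cancelled.
      ab-e₁e₂ : ∀ v → a (v ⊕ e₁) * b (v ⊕ e₂) ≈ R₁₂ v
      ab-e₁e₂ v = unit-cancelˡ (2z³-unit v) (begin
        2# * z v 0 0 ² * z v 0 0 * (a (v ⊕ e₁) * b (v ⊕ e₂))
          ≈⟨ solve 4 (λ d y a b → d :* y :* (a :* b) := (y :* a) :* (d :* b)) refl _ _ _ _ ⟩
        (z v 0 0 * a (v ⊕ e₁)) * (2# * z v 0 0 ² * b (v ⊕ e₂))
          ≈⟨ *-cong (a-step v) (b-step v) ⟩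
        (z v 1 0 * a v + b v) * (A v * a v + B v * b v)
          ≈⟨ solve 5 (λ y a b c d → (y :* a :+ b) :* (c :* a :+ d :* b)
               := y :* c :* (a :* a) :+ d :* (b :* b) :+ (y :* d :+ c) :* (a :* b)) refl _ _ _ _ _ ⟩
        z v 1 0 * A v * a v ² + B v * b v ² + (z v 1 0 * B v + A v) * (a v * b v)
          ≈⟨ +-cong (+-cong (*-congˡ (a²-eq v)) (*-congˡ (b²-eq v))) (*-congˡ (ab-eq v)) ⟩
        z v 1 0 * A v * S v + B v * C v + (z v 1 0 * B v + A v) * R₀₀ v
          ≈⟨ diagonal v (F≈0 v) ⟩
        2# * z v 0 0 ² * z v 0 0 * R₁₂ v ∎)

      product : ∀ v → CornerProduct v
      product v = begin
        R₀₀ (v ⊕ e₁₂) * R₁₀ (v ⊕ e₂) * R₁₂ v * R₀₂ (v ⊕ e₁)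
          -- Exactly two of the four neighbour products carry a minus sign.
          ≈⟨ solve 4 (λ p q u t → p :* q :* u :* t := p :* (:- q) :* u :* (:- t)) refl _ _ _ _ ⟩
        R₀₀ (v ⊕ e₁₂) * (- R₁₀ (v ⊕ e₂)) * R₁₂ v * (- R₀₂ (v ⊕ e₁))
          ≈⟨ *-cong (*-cong (*-cong (ab-eq (v ⊕ e₁₂)) (ba-e₁ (v ⊕ e₂))) (ab-e₁e₂ v)) (ab-e₂ (v ⊕ e₁)) ⟨
        a (v ⊕ e₁₂) * b (v ⊕ e₁₂) * (b (v ⊕ e₂) * a (v ⊕ e₂ ⊕ e₁))
          * (a (v ⊕ e₁) * b (v ⊕ e₂)) * (a (v ⊕ e₁) * b (v ⊕ e₁ ⊕ e₂))
          ≈⟨ *-cong (*-congʳ (*-congˡ (*-congˡ (reflexive (≡.cong a (⊕-e₂e₁ v))))))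
                    (*-congˡ (reflexive (≡.cong b (⊕-e₁e₂ v)))) ⟩
        a (v ⊕ e₁₂) * b (v ⊕ e₁₂) * (b (v ⊕ e₂) * a (v ⊕ e₁₂))
          * (a (v ⊕ e₁) * b (v ⊕ e₂)) * (a (v ⊕ e₁) * b (v ⊕ e₁₂))
          ≈⟨ solve 4 (λ a b b₂ a₁ → a :* b :* (b₂ :* a) :* (a₁ :* b₂) :* (a₁ :* b)
               := (a :* a) :* (a₁ :* a₁) :* (b :* b) :* (b₂ :* b₂)) refl _ _ _ _ ⟩
        a (v ⊕ e₁₂) ² * a (v ⊕ e₁) ² * b (v ⊕ e₁₂) ² * b (v ⊕ e₂) ²
          ≈⟨ *-cong (*-cong (*-cong (a²-eq _) (a²-eq _)) (b²-eq _)) (b²-eq _) ⟩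
        S (v ⊕ e₁₂) * S (v ⊕ e₁) * C (v ⊕ e₁₂) * C (v ⊕ e₂) ∎

open import Defs
open ≡ using (refl; sym; trans; cong; cong₂; subst; subst₂)

-- Null sequences

-- `a ≈ᴿ b` unfolds to `Null` of the difference of the two sequences. Each congruence law is thus a
-- closure property of null sequences and a rational identity.
Null : (ℕ → ℚ) → Set
Null s = ∀ ε → 0ℚ ℚ.< ε → ∃[ N ] (∀ n → N ℕ.≤ n → ℚ.∣ s n ∣ ℚ.< ε)

null-resp : ∀ {s t} → (∃[ N ] ∀ n → N ℕ.≤ n → s n ≡ t n) → Null s → Null t
null-resp (M , s≡t) hs ε 0<ε =
  let N , h = hs ε 0<ε
  in M ℕ.⊔ N , λ n ≤n → subst (ℚ._< ε) (cong ℚ.∣_∣ (s≡t n (ℕ.m⊔n≤o⇒m≤o M N ≤n)))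
       (h n (ℕ.m⊔n≤o⇒n≤o M N ≤n))

null-ext : ∀ {s t} → (∀ n → s n ≡ t n) → Null s → Null t
null-ext s≡t = null-resp (0 , λ n _ → s≡t n)

null-0 : Null (λ _ → 0ℚ)
null-0 ε 0<ε = 0 , λ _ _ → 0<ε

null-+ : ∀ {s t} → Null s → Null t → Null (λ n → s n ℚ.+ t n)
null-+ {s} {t} hs ht ε 0<ε =
  let M , h = hs (½ ℚ.* ε) (half>0 ε 0<ε)
      N , k = ht (½ ℚ.* ε) (half>0 ε 0<ε)
  in M ℕ.⊔ N , λ n ≤n → subst (ℚ.∣ s n ℚ.+ t n ∣ ℚ.<_) (half+half ε)
       (ℚ.≤-<-trans (ℚ.∣p+q∣≤∣p∣+∣q∣ (s n) (t n))
         (ℚ.+-mono-< (h n (ℕ.m⊔n≤o⇒m≤o M N ≤n)) (k n (ℕ.m⊔n≤o⇒n≤o M N ≤n))))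

null-neg : ∀ {s} → Null s → Null (λ n → ℚ.- s n)
null-neg {s} hs ε 0<ε =
  let N , h = hs ε 0<ε
  in N , λ n ≤n → subst (ℚ._< ε) (sym (ℚ.∣-p∣≡∣p∣ (s n))) (h n ≤n)

null-* : ∀ s {t} → Cauchy s → Null t → Null (λ n → s n ℚ.* t n)
null-* s {t} cs ht ε 0<ε =
  let B , 0<B , M , bs = cauchy-bounded {s} cs
      N , h = ht (ε ℚ.* recip B) (*>0 ε (recip B) 0<ε (recip>0 B 0<B))
  in M ℕ.⊔ N , λ n ≤n → let open ℚ.≤-Reasoning in begin-strict
    ℚ.∣ s n ℚ.* t n ∣            ≡⟨ ℚ.∣p*q∣≡∣p∣*∣q∣ (s n) (t n) ⟩
    ℚ.∣ s n ∣ ℚ.* ℚ.∣ t n ∣      ≤⟨ ℚ.*-monoʳ-≤-nonNeg ℚ.∣ t n ∣ {{ℚ.nonNegative (ℚ.0≤∣p∣ (t n))}}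
                                     (bs n (ℕ.m⊔n≤o⇒m≤o M N ≤n)) ⟩
    B ℚ.* ℚ.∣ t n ∣              <⟨ ℚ.*-monoʳ-<-pos B {{ℚ.positive 0<B}} (h n (ℕ.m⊔n≤o⇒n≤o M N ≤n)) ⟩
    B ℚ.* (ε ℚ.* recip B)        ≡⟨ solve 3 (λ b e r → b :* (e :* r) := (b :* r) :* e) refl B ε (recip B) ⟩
    (B ℚ.* recip B) ℚ.* ε        ≡⟨ cong (ℚ._* ε) (*-recip B 0<B) ⟩
    1ℚ ℚ.* ε                     ≡⟨ ℚ.*-identityˡ ε ⟩
    ε                            ∎
  where open +-*-Solver

null-cauchy : ∀ {s} → Null s → Cauchy s
null-cauchy {s} hs ε 0<ε =
  let N , h = hs (½ ℚ.* ε) (half>0 ε 0<ε)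
  in N , λ m n ≤m ≤n → subst (ℚ.∣ s m ℚ.- s n ∣ ℚ.<_) (half+half ε)
       (ℚ.≤-<-trans (ℚ.∣p+q∣≤∣p∣+∣q∣ (s m) (ℚ.- s n))
         (ℚ.+-mono-< (h m ≤m) (subst (ℚ._< ½ ℚ.* ε) (sym (ℚ.∣-p∣≡∣p∣ (s n))) (h n ≤n))))

cauchy-ext : ∀ {s t} → (∃[ N ] ∀ n → N ℕ.≤ n → s n ≡ t n) → Cauchy s → Cauchy t
cauchy-ext (M , s≡t) cs ε 0<ε =
  let N , h = cs ε 0<ε
  in M ℕ.⊔ N , λ m n ≤m ≤n → subst (ℚ._< ε)
       (cong ℚ.∣_∣ (cong₂ ℚ._-_ (s≡t m (ℕ.m⊔n≤o⇒m≤o M N ≤m)) (s≡t n (ℕ.m⊔n≤o⇒m≤o M N ≤n))))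
       (h m n (ℕ.m⊔n≤o⇒n≤o M N ≤m) (ℕ.m⊔n≤o⇒n≤o M N ≤n))

-- Real and complex arithmetic

eventually : ∀ {a b} → ∃[ N ] (∀ n → N ℕ.≤ n → seq a n ≡ seq b n) → a ≈ᴿ b
eventually {a} {b} (N , a≡b) = null-resp
  (N , λ n ≤n → sym (trans (cong (ℚ._- seq b n) (a≡b n ≤n)) (ℚ.+-inverseʳ (seq b n)))) null-0

pointwise : ∀ {a b : ℝ} → (∀ n → seq a n ≡ seq b n) → a ≈ᴿ b
pointwise {a} {b} a≡b = eventually {a} {b} (0 , λ n _ → a≡b n)

≈ᴿ-refl : ∀ {a} → a ≈ᴿ a
≈ᴿ-refl {a} = pointwise {a} {a} λ _ → refl

≈ᴿ-sym : ∀ {a b} → a ≈ᴿ b → b ≈ᴿ a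
≈ᴿ-sym {a} {b} a≈b = null-ext
  (λ n → solve 2 (λ x y → :- (x :- y) := y :- x) refl (seq a n) (seq b n)) (null-neg a≈b)
  where open +-*-Solver

≈ᴿ-trans : ∀ {a b c} → a ≈ᴿ b → b ≈ᴿ c → a ≈ᴿ c
≈ᴿ-trans {a} {b} {c} a≈b b≈c = null-ext
  (λ n → solve 3 (λ x y z → (x :- y) :+ (y :- z) := x :- z) refl (seq a n) (seq b n) (seq c n))
  (null-+ a≈b b≈c)
  where open +-*-Solver

+ᴿ-cong : ∀ {a b c d} → a ≈ᴿ b → c ≈ᴿ d → (a +ᴿ c) ≈ᴿ (b +ᴿ d)
+ᴿ-cong {a} {b} {c} {d} a≈b c≈d = null-ext
  (λ n → solve 4 (λ x y z w → (x :- y) :+ (z :- w) := (x :+ z) :- (y :+ w)) refl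
    (seq a n) (seq b n) (seq c n) (seq d n))
  (null-+ a≈b c≈d)
  where open +-*-Solver

-ᴿ-cong : ∀ {a b} → a ≈ᴿ b → (-ᴿ a) ≈ᴿ (-ᴿ b)
-ᴿ-cong {a} {b} a≈b = null-ext
  (λ n → solve 2 (λ x y → :- (x :- y) := (:- x) :- (:- y)) refl (seq a n) (seq b n)) (null-neg a≈b)
  where open +-*-Solver

*ᴿ-cong : ∀ {a b c d} → a ≈ᴿ b → c ≈ᴿ d → (a *ᴿ c) ≈ᴿ (b *ᴿ d)
*ᴿ-cong {a} {b} {c} {d} a≈b c≈d = null-ext
  (λ n → solve 4 (λ x y z w → x :* (z :- w) :+ w :* (x :- y) := x :* z :- y :* w) refl
    (seq a n) (seq b n) (seq c n) (seq d n))
  (null-+ (null-* (seq a) (cauchy a) c≈d) (null-* (seq d) (cauchy d) a≈b))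
  where open +-*-Solver

-- The ring of complex numbers

infix 8 -ᶜ_
-ᶜ_ : ℂ → ℂ
-ᶜ z = (-ᴿ re z) +i (-ᴿ im z)

1ℂ : ℂ
1ℂ = fromℚ 1ℚ

ℂ-commutativeRing : CommutativeRing _ _
ℂ-commutativeRing = record
  { Carrier = ℂ
  ; _≈_ = _≈_
  ; _+_ = _+_
  ; _*_ = _*_
  ; -_ = -ᶜ_
  ; 0# = 0ℂ
  ; 1# = 1ℂ
  ; isCommutativeRing = record
    { isRing = record
      { +-isAbelianGroup = record
        { isGroup = record
          { isMonoid = record
            { isSemigroup = record
              { isMagma = record
                { isEquivalence = record
                  { refl  = λ {z} → ≈ᴿ-refl {re z} , ≈ᴿ-refl {im z}
                  ; sym   = λ {z} {w} (p , q) → ≈ᴿ-sym {re z} {re w} p , ≈ᴿ-sym {im z} {im w} q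
                  ; trans = λ {z} {w} {u} (p , q) (p′ , q′) →
                      ≈ᴿ-trans {re z} {re w} {re u} p p′ , ≈ᴿ-trans {im z} {im w} {im u} q q′
                  }
                ; ∙-cong = λ {z} {w} {u} {v} (p , q) (p′ , q′) →
                    +ᴿ-cong {re z} {re w} {re u} {re v} p p′ , +ᴿ-cong {im z} {im w} {im u} {im v} q q′
                }
              ; assoc = λ z w u → byℚ (z + w + u) (z + (w + u))
                  (λ n → ℚ.+-assoc (seq (re z) n) (seq (re w) n) (seq (re u) n))
                  (λ n → ℚ.+-assoc (seq (im z) n) (seq (im w) n) (seq (im u) n))
              }
            ; identity =
                (λ z → byℚ (0ℂ + z) z (λ n → ℚ.+-identityˡ (seq (re z) n)) (λ n → ℚ.+-identityˡ (seq (im z) n))) ,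
                (λ z → byℚ (z + 0ℂ) z (λ n → ℚ.+-identityʳ (seq (re z) n)) (λ n → ℚ.+-identityʳ (seq (im z) n)))
            }
          ; inverse =
              (λ z → byℚ ((-ᶜ z) + z) 0ℂ (λ n → ℚ.+-inverseˡ (seq (re z) n)) (λ n → ℚ.+-inverseˡ (seq (im z) n))) ,
              (λ z → byℚ (z + (-ᶜ z)) 0ℂ (λ n → ℚ.+-inverseʳ (seq (re z) n)) (λ n → ℚ.+-inverseʳ (seq (im z) n)))
          ; ⁻¹-cong = λ {z} {w} (p , q) → -ᴿ-cong {re z} {re w} p , -ᴿ-cong {im z} {im w} q
          }
        ; comm = λ z w → byℚ (z + w) (w + z) (λ n → ℚ.+-comm (seq (re z) n) (seq (re w) n))
                             (λ n → ℚ.+-comm (seq (im z) n) (seq (im w) n))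
        }
      ; *-cong = λ {z} {w} {u} {v} (p , q) (p′ , q′) →
          +ᴿ-cong {re z *ᴿ re u} {re w *ᴿ re v} { -ᴿ (im z *ᴿ im u)} { -ᴿ (im w *ᴿ im v)}
            (*ᴿ-cong {re z} {re w} {re u} {re v} p p′)
            (-ᴿ-cong {im z *ᴿ im u} {im w *ᴿ im v} (*ᴿ-cong {im z} {im w} {im u} {im v} q q′)) ,
          +ᴿ-cong {re z *ᴿ im u} {re w *ᴿ im v} {im z *ᴿ re u} {im w *ᴿ re v}
            (*ᴿ-cong {re z} {re w} {im u} {im v} p q′)
            (*ᴿ-cong {im z} {im w} {re u} {re v} q p′)
      ; *-assoc = λ z w u → byℚ (z * w * u) (z * (w * u))
          (λ n → solve 6 (λ a b c d e f →
            (a :* c :- b :* d) :* e :- (a :* d :+ b :* c) :* f :=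
            a :* (c :* e :- d :* f) :- b :* (c :* f :+ d :* e)) refl
            (seq (re z) n) (seq (im z) n) (seq (re w) n) (seq (im w) n) (seq (re u) n) (seq (im u) n))
          (λ n → solve 6 (λ a b c d e f →
            (a :* c :- b :* d) :* f :+ (a :* d :+ b :* c) :* e :=
            a :* (c :* f :+ d :* e) :+ b :* (c :* e :- d :* f)) refl
            (seq (re z) n) (seq (im z) n) (seq (re w) n) (seq (im w) n) (seq (re u) n) (seq (im u) n))
      ; *-identity =
          (λ z → byℚ (1ℂ * z) z
            (λ n → solve 2 (λ a b → con 1ℚ :* a :- con 0ℚ :* b := a) refl (seq (re z) n) (seq (im z) n))
            (λ n → solve 2 (λ a b → con 1ℚ :* b :+ con 0ℚ :* a := b) refl (seq (re z) n) (seq (im z) n))) ,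
          (λ z → byℚ (z * 1ℂ) z
            (λ n → solve 2 (λ a b → a :* con 1ℚ :- b :* con 0ℚ := a) refl (seq (re z) n) (seq (im z) n))
            (λ n → solve 2 (λ a b → a :* con 0ℚ :+ b :* con 1ℚ := b) refl (seq (re z) n) (seq (im z) n)))
      ; distrib =
          (λ z w u → byℚ (z * (w + u)) (z * w + z * u)
            (λ n → solve 6 (λ a b c d e f →
              a :* (c :+ e) :- b :* (d :+ f) := (a :* c :- b :* d) :+ (a :* e :- b :* f)) refl
              (seq (re z) n) (seq (im z) n) (seq (re w) n) (seq (im w) n) (seq (re u) n) (seq (im u) n))
            (λ n → solve 6 (λ a b c d e f →
              a :* (d :+ f) :+ b :* (c :+ e) := (a :* d :+ b :* c) :+ (a :* f :+ b :* e)) refl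
              (seq (re z) n) (seq (im z) n) (seq (re w) n) (seq (im w) n) (seq (re u) n) (seq (im u) n))) ,
          (λ z w u → byℚ ((w + u) * z) (w * z + u * z)
            (λ n → solve 6 (λ a b c d e f →
              (c :+ e) :* a :- (d :+ f) :* b := (c :* a :- d :* b) :+ (e :* a :- f :* b)) refl
              (seq (re z) n) (seq (im z) n) (seq (re w) n) (seq (im w) n) (seq (re u) n) (seq (im u) n))
            (λ n → solve 6 (λ a b c d e f →
              (c :+ e) :* b :+ (d :+ f) :* a := (c :* b :+ d :* a) :+ (e :* b :+ f :* a)) refl
              (seq (re z) n) (seq (im z) n) (seq (re w) n) (seq (im w) n) (seq (re u) n) (seq (im u) n)))
      }
    ; *-comm = λ z w → byℚ (z * w) (w * z)
        (λ n → solve 4 (λ a b c d → a :* c :- b :* d := c :* a :- d :* b) refl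
          (seq (re z) n) (seq (im z) n) (seq (re w) n) (seq (im w) n))
        (λ n → solve 4 (λ a b c d → a :* d :+ b :* c := c :* b :+ d :* a) refl
          (seq (re z) n) (seq (im z) n) (seq (re w) n) (seq (im w) n))
    }
  }
  where
  open +-*-Solver
  byℚ : ∀ z w → (∀ n → seq (re z) n ≡ seq (re w) n) → (∀ n → seq (im z) n ≡ seq (im w) n) → z ≈ w
  byℚ z w p q = pointwise {re z} {re w} p , pointwise {im z} {im w} q

-- With denominator 1 written directly instead of by a normalising division, this computes for a
-- variable `i`, and its values at 2 and 4 agree by computation with those in `2ℂ` and `4ℂ`.
ℤ→ℚ : ℤ → ℚ
ℤ→ℚ i = mkℚ i 0 (Coprimality.sym (Coprimality.1-coprimeTo _))

ℤ→ℚ-homo-+ : ∀ i j → ℤ→ℚ (i ℤ.+ j) ≡ ℤ→ℚ i ℚ.+ ℤ→ℚ j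
ℤ→ℚ-homo-+ i j = ℚ.toℚᵘ-injective (ℚᵘ.≃-trans
  (ℚᵘ.*≡* (cong (ℤ._* + 1) (cong₂ ℤ._+_ (sym (ℤ.*-identityʳ i)) (sym (ℤ.*-identityʳ j)))))
  (ℚᵘ.≃-sym (ℚ.toℚᵘ-homo-+ (ℤ→ℚ i) (ℤ→ℚ j))))

ℤ→ℚ-homo-* : ∀ i j → ℤ→ℚ (i ℤ.* j) ≡ ℤ→ℚ i ℚ.* ℤ→ℚ j
ℤ→ℚ-homo-* i j = ℚ.toℚᵘ-injective (ℚᵘ.≃-sym (ℚ.toℚᵘ-homo-* (ℤ→ℚ i) (ℤ→ℚ j)))

ℤ→ℚ-homo-neg : ∀ i → ℤ→ℚ (ℤ.- i) ≡ ℚ.- ℤ→ℚ i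
ℤ→ℚ-homo-neg i = ℚ.toℚᵘ-injective (ℚᵘ.≃-sym (ℚ.toℚᵘ-homo‿- (ℤ→ℚ i)))

ℤ→ℂ : ℤ-rawRing -Raw-AlmostCommutative⟶ fromCommutativeRing ℂ-commutativeRing
ℤ→ℂ = record
  { ⟦_⟧ = ι
  ; +-homo = λ i j →
      pointwise {re (ι (i ℤ.+ j))} {re (ι i + ι j)} (λ _ → ℤ→ℚ-homo-+ i j) ,
      pointwise {im (ι (i ℤ.+ j))} {im (ι i + ι j)} (λ _ → refl)
  ; *-homo = λ i j →
      pointwise {re (ι (i ℤ.* j))} {re (ι i * ι j)} (λ _ → trans (ℤ→ℚ-homo-* i j)
        (solve 1 (λ p → p := p :- con 0ℚ :* con 0ℚ) refl (ℤ→ℚ i ℚ.* ℤ→ℚ j))) ,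
      pointwise {im (ι (i ℤ.* j))} {im (ι i * ι j)} (λ _ →
        solve 2 (λ p q → con 0ℚ := p :* con 0ℚ :+ con 0ℚ :* q) refl (ℤ→ℚ i) (ℤ→ℚ j))
  ; -‿homo = λ i →
      pointwise {re (ι (ℤ.- i))} {re (-ᶜ ι i)} (λ _ → ℤ→ℚ-homo-neg i) ,
      pointwise {im (ι (ℤ.- i))} {im (-ᶜ ι i)} (λ _ → refl)
  ; 0-homo = ≈ᴿ-refl {re 0ℂ} , ≈ᴿ-refl {im 0ℂ}
  ; 1-homo = ≈ᴿ-refl {re 1ℂ} , ≈ᴿ-refl {im 1ℂ}
  }
  where
  open +-*-Solver
  ι : ℤ → ℂ
  ι i = fromℚ (ℤ→ℚ i)

*ᴿ-inverse : ∀ a a>0 → (a *ᴿ invᴿ a a>0) ≈ᴿ fromℚᴿ 1ℚ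
*ᴿ-inverse a a>0@(δ , 0<δ , N , δ≤a) = eventually {a *ᴿ invᴿ a a>0} {fromℚᴿ 1ℚ}
  (N , λ n ≤n → *-recip (seq a n) (ℚ.<-≤-trans 0<δ (δ≤a n ≤n)))

*-inv : ∀ z → val z * inv z ≈ 1ℂ
*-inv zˣ@(mkℂˣ z z≠0) =
  ≈ᴿ-trans {re (z * inv zˣ)} {normSq z *ᴿ r} {re 1ℂ}
    (pointwise {re (z * inv zˣ)} {normSq z *ᴿ r} λ n →
      solve 3 (λ a b r → a :* (a :* r) :- b :* ((:- b) :* r) := (a :* a :+ b :* b) :* r) refl
        (seq (re z) n) (seq (im z) n) (seq r n))
    (*ᴿ-inverse (normSq z) z≠0) ,
  pointwise {im (z * inv zˣ)} {im 1ℂ} λ n →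
    solve 3 (λ a b r → a :* ((:- b) :* r) :+ b :* (a :* r) := con 0ℚ) refl
      (seq (re z) n) (seq (im z) n) (seq r n)
  where
  open +-*-Solver
  r : ℝ
  r = invᴿ (normSq z) z≠0

-- Square roots

1/[1+_] : ℕ → ℚ
1/[1+ n ] = mkℚ (+ 1) n (Coprimality.1-coprimeTo (suc n))

1/[1+n]>0 : ∀ n → 0ℚ ℚ.< 1/[1+ n ]
1/[1+n]>0 n = ℚ.positive⁻¹ 1/[1+ n ]

1/[1+n]-null : ∀ ε → 0ℚ ℚ.< ε → ∃[ N ] (∀ n → N ℕ.≤ n → 1/[1+ n ] ℚ.< ε)
1/[1+n]-null (mkℚ (+ 0) d _) (ℚ.*<* (ℤ.+<+ ()))
1/[1+n]-null (mkℚ -[1+ p ] d _) (ℚ.*<* ())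
1/[1+n]-null (mkℚ +[1+ p ] d _) _ = suc d , λ n d<n → ℚ.*<* (ℤ.+<+ (begin-strict
  1 ℕ.* suc d          ≡⟨ ℕ.*-identityˡ (suc d) ⟩
  suc d                <⟨ s≤s d<n ⟩
  suc n                ≤⟨ ℕ.m≤n*m (suc n) (suc p) ⟩
  suc p ℕ.* suc n      ∎))
  where open ℕ.≤-Reasoning

-- Newton's iteration at least halves the excess at each step. Recording only this harmonic rate
-- avoids powers of 2, and `1/[1+n]-null` then gives convergence.
½/[1+n]≤1/[2+n] : ∀ n → ½ ℚ.* 1/[1+ n ] ℚ.≤ 1/[1+ suc n ]
½/[1+n]≤1/[2+n] n = ℚ.toℚᵘ-cancel-≤ (ℚᵘ.≤-respˡ-≃ (ℚᵘ.≃-sym (ℚ.toℚᵘ-homo-* ½ 1/[1+ n ]))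
  (ℚᵘ.*≤* (ℤ.+≤+ (begin
    1 ℕ.* suc (suc n)          ≤⟨ ℕ.*-monoʳ-≤ 1 (s≤s (ℕ.m≤n+m (suc n) n)) ⟩
    1 ℕ.* (suc n ℕ.+ suc n)    ≡⟨ cong (λ k → 1 ℕ.* (suc n ℕ.+ k)) (sym (ℕ.+-identityʳ (suc n))) ⟩
    1 ℕ.* (2 ℕ.* suc n)        ∎))))
  where open ℕ.≤-Reasoning

0≤p*p : ∀ p → 0ℚ ℚ.≤ p ℚ.* p
0≤p*p p with ℚ.≤-total 0ℚ p
... | inj₁ 0≤p = subst (ℚ._≤ p ℚ.* p) (ℚ.*-zeroʳ p) (ℚ.*-monoˡ-≤-nonNeg p {{ℚ.nonNegative 0≤p}} 0≤p)
... | inj₂ p≤0 = subst (ℚ._≤ p ℚ.* p) (ℚ.*-zeroʳ p) (ℚ.*-monoˡ-≤-nonPos p {{ℚ.nonPositive p≤0}} p≤0)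

-- Newton's iteration x ↦ (x + q/x)/2 with excess e = x² - q: the new
-- excess is d²/4 for d = e/x, and d ≤ x.
newton-step : ∀ {q x e} → 0ℚ ℚ.≤ q → 0ℚ ℚ.< x → 0ℚ ℚ.≤ e → x ℚ.* x ≡ q ℚ.+ e →
  ∃[ x′ ] ∃[ e′ ] (0ℚ ℚ.< x′ × 0ℚ ℚ.≤ e′ × x′ ℚ.* x′ ≡ q ℚ.+ e′ × e′ ℚ.≤ ½ ℚ.* e)
newton-step {q} {x} {e} 0≤q 0<x 0≤e x²≡q+e =
  ½ ℚ.* (x ℚ.+ q ℚ.* y) , ½ ℚ.* d ℚ.* (½ ℚ.* d) ,
  half>0 _ (ℚ.+-mono-<-≤ 0<x 0≤qy) , 0≤p*p (½ ℚ.* d) ,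
  (begin-equality
    ½ ℚ.* (x ℚ.+ q ℚ.* y) ℚ.* (½ ℚ.* (x ℚ.+ q ℚ.* y))
      ≡⟨ solve 3 (λ x q y → con ½ :* (x :+ q :* y) :* (con ½ :* (x :+ q :* y)) :=
           q :* (x :* y) :+ con ½ :* (x :- q :* y) :* (con ½ :* (x :- q :* y))) refl x q y ⟩
    q ℚ.* (x ℚ.* y) ℚ.+ ½ ℚ.* d ℚ.* (½ ℚ.* d)
      ≡⟨ cong (ℚ._+ ½ ℚ.* d ℚ.* (½ ℚ.* d)) (trans (cong (q ℚ.*_) xy≡1) (ℚ.*-identityʳ q)) ⟩
    q ℚ.+ ½ ℚ.* d ℚ.* (½ ℚ.* d) ∎) ,
  (begin
    ½ ℚ.* d ℚ.* (½ ℚ.* d)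
      ≡⟨ solve 1 (λ d → con ½ :* d :* (con ½ :* d) := con ½ :* (con ½ :* (d :* d))) refl d ⟩
    ½ ℚ.* (½ ℚ.* (d ℚ.* d))
      ≤⟨ ℚ.*-monoˡ-≤-nonNeg ½ (ℚ.*-monoˡ-≤-nonNeg ½ (ℚ.*-monoˡ-≤-nonNeg d {{ℚ.nonNegative 0≤d}} d≤x)) ⟩
    ½ ℚ.* (½ ℚ.* (d ℚ.* x))
      ≡⟨ cong (λ p → ½ ℚ.* (½ ℚ.* p)) dx≡e ⟩
    ½ ℚ.* (½ ℚ.* e)
      ≤⟨ ℚ.*-monoˡ-≤-nonNeg ½ (ℚ.*-monoʳ-≤-nonNeg e {{ℚ.nonNegative 0≤e}} (from-yes (½ ℚ.≤? 1ℚ))) ⟩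
    ½ ℚ.* (1ℚ ℚ.* e)
      ≡⟨ cong (½ ℚ.*_) (ℚ.*-identityˡ e) ⟩
    ½ ℚ.* e ∎)
  where
  open ℚ.≤-Reasoning
  open +-*-Solver
  y d : ℚ
  y = recip x
  d = x ℚ.- q ℚ.* y
  xy≡1 : x ℚ.* y ≡ 1ℚ
  xy≡1 = *-recip x 0<x
  0≤y : 0ℚ ℚ.≤ y
  0≤y = ℚ.<⇒≤ (recip>0 x 0<x)
  0≤qy : 0ℚ ℚ.≤ q ℚ.* y
  0≤qy = subst (ℚ._≤ q ℚ.* y) (ℚ.*-zeroˡ y) (ℚ.*-monoʳ-≤-nonNeg y {{ℚ.nonNegative 0≤y}} 0≤q)
  dx≡e : d ℚ.* x ≡ e
  dx≡e = begin-equality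
    d ℚ.* x
      ≡⟨ solve 3 (λ x q y → (x :- q :* y) :* x := x :* x :- q :* (x :* y)) refl x q y ⟩
    x ℚ.* x ℚ.- q ℚ.* (x ℚ.* y)    ≡⟨ cong₂ (λ s t → s ℚ.- q ℚ.* t) x²≡q+e xy≡1 ⟩
    q ℚ.+ e ℚ.- q ℚ.* 1ℚ           ≡⟨ solve 2 (λ q e → q :+ e :- q :* con 1ℚ := e) refl q e ⟩
    e                              ∎
  d≡ey : d ≡ e ℚ.* y
  d≡ey = begin-equality
    d                  ≡⟨ trans (cong (d ℚ.*_) xy≡1) (ℚ.*-identityʳ d) ⟨
    d ℚ.* (x ℚ.* y)    ≡⟨ ℚ.*-assoc d x y ⟨
    d ℚ.* x ℚ.* y      ≡⟨ cong (ℚ._* y) dx≡e ⟩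
    e ℚ.* y            ∎
  0≤d : 0ℚ ℚ.≤ d
  0≤d = begin
    0ℚ           ≡⟨ ℚ.*-zeroˡ y ⟨
    0ℚ ℚ.* y     ≤⟨ ℚ.*-monoʳ-≤-nonNeg y {{ℚ.nonNegative 0≤y}} 0≤e ⟩
    e ℚ.* y      ≡⟨ d≡ey ⟨
    d            ∎
  d≤x : d ℚ.≤ x
  d≤x = begin
    x ℚ.- q ℚ.* y  ≤⟨ ℚ.+-monoʳ-≤ x (ℚ.neg-antimono-≤ 0≤qy) ⟩
    x ℚ.+ 0ℚ       ≡⟨ ℚ.+-identityʳ x ⟩
    x              ∎

newton : ∀ {q x e} → 0ℚ ℚ.≤ q → 0ℚ ℚ.< x → 0ℚ ℚ.≤ e → x ℚ.* x ≡ q ℚ.+ e → ∀ k →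
  ∃[ x′ ] ∃[ e′ ] (0ℚ ℚ.< x′ × 0ℚ ℚ.≤ e′ × x′ ℚ.* x′ ≡ q ℚ.+ e′ × e′ ℚ.≤ e ℚ.* 1/[1+ k ])
newton {q} {x} {e} 0≤q 0<x 0≤e x² zero =
  x , e , 0<x , 0≤e , x² , ℚ.≤-reflexive (sym (ℚ.*-identityʳ e))
newton {q} {x} {e} 0≤q 0<x 0≤e x² (suc k) =
  let _ , e₁ , 0<x₁ , 0≤e₁ , x₁² , e₁≤ = newton 0≤q 0<x 0≤e x² k
      x₂ , e₂ , 0<x₂ , 0≤e₂ , x₂² , e₂≤ = newton-step 0≤q 0<x₁ 0≤e₁ x₁²
  in x₂ , e₂ , 0<x₂ , 0≤e₂ , x₂² , (begin
    e₂                           ≤⟨ e₂≤ ⟩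
    ½ ℚ.* e₁                     ≤⟨ ℚ.*-monoˡ-≤-nonNeg ½ e₁≤ ⟩
    ½ ℚ.* (e ℚ.* 1/[1+ k ])      ≡⟨ swap ½ e 1/[1+ k ] ⟩
    e ℚ.* (½ ℚ.* 1/[1+ k ])      ≤⟨ ℚ.*-monoˡ-≤-nonNeg e {{ℚ.nonNegative 0≤e}} (½/[1+n]≤1/[2+n] k) ⟩
    e ℚ.* 1/[1+ suc k ]          ∎)
  where
  open ℚ.≤-Reasoning
  swap : ∀ p q r → p ℚ.* (q ℚ.* r) ≡ q ℚ.* (p ℚ.* r)
  swap = solve 3 (λ p q r → p :* (q :* r) := q :* (p :* r)) refl
    where open +-*-Solver

sqrtℚ : ∀ q δ → 0ℚ ℚ.≤ q → 0ℚ ℚ.< δ →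
  ∃[ x ] ∃[ e ] (0ℚ ℚ.< x × 0ℚ ℚ.≤ e × x ℚ.* x ≡ q ℚ.+ e × e ℚ.< δ)
sqrtℚ q δ 0≤q 0<δ =
  let N , small = 1/[1+n]-null (δ ℚ.* recip E) (*>0 δ (recip E) 0<δ (recip>0 E 0<E))
      -- The start is `q ℚ.+ 1ℚ`, which is positive and overestimates the root; its excess is `E`.
      x , e , 0<x , 0≤e , x² , e≤ = newton 0≤q (ℚ.+-mono-≤-< 0≤q 0<1) (ℚ.<⇒≤ 0<E) (expand q) N
  in x , e , 0<x , 0≤e , x² , (begin-strict
    e                          ≤⟨ e≤ ⟩
    E ℚ.* 1/[1+ N ]            <⟨ ℚ.*-monoʳ-<-pos E {{ℚ.positive 0<E}} (small N ℕ.≤-refl) ⟩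
    E ℚ.* (δ ℚ.* recip E)      ≡⟨ swap E δ (recip E) ⟩
    (E ℚ.* recip E) ℚ.* δ      ≡⟨ cong (ℚ._* δ) (*-recip E 0<E) ⟩
    1ℚ ℚ.* δ                   ≡⟨ ℚ.*-identityˡ δ ⟩
    δ                          ∎)
  where
  open ℚ.≤-Reasoning
  open +-*-Solver
  E : ℚ
  E = q ℚ.* q ℚ.+ q ℚ.+ 1ℚ
  0<1 : 0ℚ ℚ.< 1ℚ
  0<1 = from-yes (0ℚ ℚ.<? 1ℚ)
  0<E : 0ℚ ℚ.< E
  0<E = ℚ.+-mono-≤-< (ℚ.+-mono-≤ (0≤p*p q) 0≤q) 0<1
  expand : ∀ q → (q ℚ.+ 1ℚ) ℚ.* (q ℚ.+ 1ℚ) ≡ q ℚ.+ (q ℚ.* q ℚ.+ q ℚ.+ 1ℚ)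
  expand = solve 1 (λ q → (q :+ con 1ℚ) :* (q :+ con 1ℚ) := q :+ (q :* q :+ q :+ con 1ℚ)) refl
  swap : ∀ a b c → a ℚ.* (b ℚ.* c) ≡ (a ℚ.* c) ℚ.* b
  swap = solve 3 (λ b e r → b :* (e :* r) := (b :* r) :* e) refl

-- If r is at most 1, then r is at least its own square. This gives a rational lower bound for a
-- root without taking the root of `δ`.
⊓1≤root : ∀ {δ r} → 0ℚ ℚ.< r → δ ℚ.≤ r ℚ.* r → δ ℚ.⊓ 1ℚ ℚ.≤ r
⊓1≤root {δ} {r} 0<r δ≤r² with ℚ.≤-total 1ℚ r
... | inj₁ 1≤r = ℚ.≤-trans (ℚ.p⊓q≤q δ 1ℚ) 1≤r
... | inj₂ r≤1 = ℚ.≤-trans (ℚ.p⊓q≤p δ 1ℚ) (ℚ.≤-trans δ≤r² (subst (r ℚ.* r ℚ.≤_) (ℚ.*-identityʳ r)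
  (ℚ.*-monoˡ-≤-nonNeg r {{ℚ.nonNegative (ℚ.<⇒≤ 0<r)}} r≤1)))

⊓1>0 : ∀ {δ} → 0ℚ ℚ.< δ → 0ℚ ℚ.< δ ℚ.⊓ 1ℚ
⊓1>0 {δ} 0<δ with ℚ.⊓-sel δ 1ℚ
... | inj₁ eq = subst (0ℚ ℚ.<_) (sym eq) 0<δ
... | inj₂ eq = subst (0ℚ ℚ.<_) (sym eq) (from-yes (0ℚ ℚ.<? 1ℚ))

-- The difference of squares is the difference times the sum, and the sum is at least `η`.
root-cauchy : ∀ {s η} → 0ℚ ℚ.< η → (∃[ N ] ∀ n → N ℕ.≤ n → η ℚ.≤ s n) →
  Cauchy (λ n → s n ℚ.* s n) → Cauchy s
root-cauchy {s} {η} 0<η (M , η≤s) cs² ε 0<ε =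
  let N , h = cs² (ε ℚ.* η) (*>0 ε η 0<ε 0<η)
  in M ℕ.⊔ N , λ m n ≤m ≤n →
    bound (s m) (s n) (η≤s m (ℕ.m⊔n≤o⇒m≤o M N ≤m)) (η≤s n (ℕ.m⊔n≤o⇒m≤o M N ≤n))
      (h m n (ℕ.m⊔n≤o⇒n≤o M N ≤m) (ℕ.m⊔n≤o⇒n≤o M N ≤n))
  where
  bound : ∀ p q → η ℚ.≤ p → η ℚ.≤ q → ℚ.∣ p ℚ.* p ℚ.- q ℚ.* q ∣ ℚ.< ε ℚ.* η → ℚ.∣ p ℚ.- q ∣ ℚ.< ε
  bound p q η≤p η≤q Δ = ℚ.*-cancelʳ-<-nonNeg η {{ℚ.nonNegative (ℚ.<⇒≤ 0<η)}} (begin-strict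
    ℚ.∣ p ℚ.- q ∣ ℚ.* η
      ≤⟨ ℚ.*-monoˡ-≤-nonNeg ℚ.∣ p ℚ.- q ∣ {{ℚ.nonNegative (ℚ.0≤∣p∣ (p ℚ.- q))}} η≤p+q ⟩
    ℚ.∣ p ℚ.- q ∣ ℚ.* (p ℚ.+ q)
      ≡⟨ cong (ℚ.∣ p ℚ.- q ∣ ℚ.*_) (ℚ.0≤p⇒∣p∣≡p (ℚ.≤-trans (ℚ.<⇒≤ 0<η) η≤p+q)) ⟨
    ℚ.∣ p ℚ.- q ∣ ℚ.* ℚ.∣ p ℚ.+ q ∣      ≡⟨ ℚ.∣p*q∣≡∣p∣*∣q∣ (p ℚ.- q) (p ℚ.+ q) ⟨
    ℚ.∣ (p ℚ.- q) ℚ.* (p ℚ.+ q) ∣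
      ≡⟨ cong ℚ.∣_∣ (solve 2 (λ p q → (p :- q) :* (p :+ q) := p :* p :- q :* q) refl p q) ⟩
    ℚ.∣ p ℚ.* p ℚ.- q ℚ.* q ∣            <⟨ Δ ⟩
    ε ℚ.* η                              ∎)
    where
    open ℚ.≤-Reasoning
    open +-*-Solver
    η≤p+q : η ℚ.≤ p ℚ.+ q
    η≤p+q = begin
      η           ≡⟨ ℚ.+-identityʳ η ⟨
      η ℚ.+ 0ℚ    ≤⟨ ℚ.+-mono-≤ η≤p (ℚ.≤-trans (ℚ.<⇒≤ 0<η) η≤q) ⟩
      p ℚ.+ q     ∎

sqrtᴿ : ∀ a → Positiveᴿ a → ∃[ r ] (Positiveᴿ r × (r *ᴿ r) ≈ᴿ a)
sqrtᴿ a (δ , 0<δ , N , δ≤a) = mkℝ r r-cauchy , (δ ℚ.⊓ 1ℚ , ⊓1>0 0<δ , N , r≥) , r²≈a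
  where
  approx : ∀ n → _
  -- Early terms of `seq a` may be negative; from `N` on the absolute value changes nothing. The
  -- roots of different terms are unrelated, and `root-cauchy` ties them together.
  approx n = sqrtℚ ℚ.∣ seq a n ∣ 1/[1+ n ] (ℚ.0≤∣p∣ (seq a n)) (1/[1+n]>0 n)
  r e : ℕ → ℚ
  r n = proj₁ (approx n)
  e n = proj₁ (proj₂ (approx n))
  0≤e : ∀ n → 0ℚ ℚ.≤ e n
  0≤e n = proj₁ (proj₂ (proj₂ (proj₂ (approx n))))
  r² : ∀ n → N ℕ.≤ n → r n ℚ.* r n ≡ seq a n ℚ.+ e n
  r² n ≤n = trans (proj₁ (proj₂ (proj₂ (proj₂ (proj₂ (approx n))))))
    (cong (ℚ._+ e n) (ℚ.0≤p⇒∣p∣≡p (ℚ.≤-trans (ℚ.<⇒≤ 0<δ) (δ≤a n ≤n))))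
  e-null : Null e
  e-null ε 0<ε =
    let M , small = 1/[1+n]-null ε 0<ε
    in M , λ n ≤n → subst (ℚ._< ε) (sym (ℚ.0≤p⇒∣p∣≡p (0≤e n)))
         (ℚ.<-trans (proj₂ (proj₂ (proj₂ (proj₂ (proj₂ (approx n)))))) (small n ≤n))
  r≥ : ∀ n → N ℕ.≤ n → δ ℚ.⊓ 1ℚ ℚ.≤ r n
  r≥ n ≤n = ⊓1≤root (proj₁ (proj₂ (proj₂ (approx n)))) (begin
    δ                  ≤⟨ δ≤a n ≤n ⟩
    seq a n            ≡⟨ ℚ.+-identityʳ (seq a n) ⟨
    seq a n ℚ.+ 0ℚ     ≤⟨ ℚ.+-monoʳ-≤ (seq a n) (0≤e n) ⟩
    seq a n ℚ.+ e n    ≡⟨ r² n ≤n ⟨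
    r n ℚ.* r n        ∎)
    where open ℚ.≤-Reasoning
  r-cauchy : Cauchy r
  r-cauchy = root-cauchy (⊓1>0 0<δ) (N , r≥)
    (cauchy-ext (N , λ n ≤n → sym (r² n ≤n)) (+-cauchy {seq a} {e} (cauchy a) (null-cauchy e-null)))
  r²≈a : (mkℝ r r-cauchy *ᴿ mkℝ r r-cauchy) ≈ᴿ a
  r²≈a = null-resp (N , λ n ≤n → sym (trans (cong (ℚ._- seq a n) (r² n ≤n))
    (solve 2 (λ a e → (a :+ e) :- a := e) refl (seq a n) (e n)))) e-null
    where open +-*-Solver

half-bound : ∀ {η r a b} → η ℚ.≤ r → 0ℚ ℚ.≤ b → ℚ.∣ b ℚ.- a ∣ ℚ.< ½ ℚ.* η → ½ ℚ.* η ℚ.≤ r ℚ.+ a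
half-bound {η} {r} {a} {b} η≤r 0≤b Δ = begin
  ½ ℚ.* η                                  ≡⟨ rearrange₁ η ⟩
  η ℚ.+ (0ℚ ℚ.- ½ ℚ.* η)                   ≤⟨ ℚ.+-mono-≤ η≤r (ℚ.+-mono-≤ 0≤b (ℚ.neg-antimono-≤ b-a≤)) ⟩
  r ℚ.+ (b ℚ.- (b ℚ.- a))                  ≡⟨ rearrange₂ r a b ⟩
  r ℚ.+ a                                  ∎
  where
  open ℚ.≤-Reasoning
  open +-*-Solver
  p≤∣p∣ : ∀ p → p ℚ.≤ ℚ.∣ p ∣
  p≤∣p∣ p with ℚ.≤-total 0ℚ p
  ... | inj₁ 0≤p = ℚ.≤-reflexive (sym (ℚ.0≤p⇒∣p∣≡p 0≤p))
  ... | inj₂ p≤0 = ℚ.≤-trans p≤0 (ℚ.0≤∣p∣ p)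
  b-a≤ : b ℚ.- a ℚ.≤ ½ ℚ.* η
  b-a≤ = ℚ.≤-trans (p≤∣p∣ (b ℚ.- a)) (ℚ.<⇒≤ Δ)
  rearrange₁ : ∀ η → ½ ℚ.* η ≡ η ℚ.+ (0ℚ ℚ.- ½ ℚ.* η)
  rearrange₁ = solve 1 (λ η → con ½ :* η := η :+ (con 0ℚ :- con ½ :* η)) refl
  rearrange₂ : ∀ r a b → r ℚ.+ (b ℚ.- (b ℚ.- a)) ≡ r ℚ.+ a
  rearrange₂ = solve 3 (λ r a b → r :+ (b :- (b :- a)) := r :+ a) refl

-- The sign of the real `a` is not decidable, but that of one rational term within half of `η` of
-- all later terms is. If this term is nonnegative, `a` stays above minus half of `η`; otherwise its
-- negative does.
r+a∨r-a>0 : ∀ r a → Positiveᴿ r → Positiveᴿ (r +ᴿ a) ⊎ Positiveᴿ (r -ᴿ a)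
r+a∨r-a>0 r a (η , 0<η , M , η≤r) = decide (ℚ.≤-total 0ℚ (seq a N))
  where
  N : ℕ
  N = proj₁ (cauchy a (½ ℚ.* η) (half>0 η 0<η))
  near : ∀ n → N ℕ.≤ n → ℚ.∣ seq a N ℚ.- seq a n ∣ ℚ.< ½ ℚ.* η
  near n = proj₂ (cauchy a (½ ℚ.* η) (half>0 η 0<η)) N n ℕ.≤-refl
  flip : ∀ p q → q ℚ.- p ≡ ℚ.- p ℚ.- ℚ.- q
  flip = solve 2 (λ p q → q :- p := :- p :- :- q) refl
    where open +-*-Solver
  decide : (0ℚ ℚ.≤ seq a N) ⊎ (seq a N ℚ.≤ 0ℚ) → Positiveᴿ (r +ᴿ a) ⊎ Positiveᴿ (r -ᴿ a)
  decide (inj₁ 0≤aN) = inj₁ (½ ℚ.* η , half>0 η 0<η , M ℕ.⊔ N , λ n ≤n →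
    half-bound (η≤r n (ℕ.m⊔n≤o⇒m≤o M N ≤n)) 0≤aN (near n (ℕ.m⊔n≤o⇒n≤o M N ≤n)))
  decide (inj₂ aN≤0) = inj₂ (½ ℚ.* η , half>0 η 0<η , M ℕ.⊔ N , λ n ≤n →
    half-bound (η≤r n (ℕ.m⊔n≤o⇒m≤o M N ≤n)) (ℚ.neg-antimono-≤ aN≤0)
      (subst (ℚ._< ½ ℚ.* η)
        (trans (∣-∣-comm (seq a N) (seq a n)) (cong ℚ.∣_∣ (flip (seq a N) (seq a n))))
        (near n (ℕ.m⊔n≤o⇒n≤o M N ≤n))))

-- Complex square roots

ofℝ : ℝ → ℂ
ofℝ r = r +i fromℚᴿ 0ℚ

conj : ℂ → ℂ
conj z = re z +i (-ᴿ im z)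

module ℂ-Ring = CommutativeRing ℂ-commutativeRing
module ℂ-Lattice = Lattice ℂ-commutativeRing ℤ→ℂ

ofℝ-* : ∀ {r s t} → (r *ᴿ s) ≈ᴿ t → ofℝ r * ofℝ s ≈ ofℝ t
ofℝ-* {r} {s} {t} rs≈t =
  ≈ᴿ-trans {re (ofℝ r * ofℝ s)} {r *ᴿ s} {t}
    (pointwise {re (ofℝ r * ofℝ s)} {r *ᴿ s} λ n →
      solve 2 (λ r s → r :* s :- con 0ℚ :* con 0ℚ := r :* s) refl (seq r n) (seq s n))
    rs≈t ,
  pointwise {im (ofℝ r * ofℝ s)} {im (ofℝ t)} λ n →
    solve 2 (λ r s → r :* con 0ℚ :+ con 0ℚ :* s := con 0ℚ) refl (seq r n) (seq s n)
  where open +-*-Solver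

Positiveᴿ-double : ∀ {a} → Positiveᴿ a → Positiveᴿ (a +ᴿ a)
Positiveᴿ-double {a} (δ , 0<δ , N , δ≤a) =
  δ ℚ.+ δ , ℚ.+-mono-< 0<δ 0<δ , N , λ n ≤n → ℚ.+-mono-≤ (δ≤a n ≤n) (δ≤a n ≤n)

-- Here `σ` is the root of twice the sum of `ρ` and the real part of `z`, which has to be positive.
-- The formula therefore fails on the negative real axis.
sqrt-right : ∀ z ρ → (ρ *ᴿ ρ) ≈ᴿ normSq z → Positiveᴿ (ρ +ᴿ re z) → ∃[ w ] w ² ≈ z
sqrt-right z ρ ρ² pos =
  let σ , σ>0 , σ² = sqrtᴿ ((ρ +ᴿ re z) +ᴿ (ρ +ᴿ re z)) (Positiveᴿ-double {ρ +ᴿ re z} pos)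
  in (z + ofℝ ρ) * ofℝ (invᴿ σ σ>0) , ℂ-Lattice.sqrt-formula {z} {conj z} {ofℝ ρ} {ofℝ σ} {ofℝ (invᴿ σ σ>0)}
       (ℂ-Ring.trans {ofℝ ρ * ofℝ ρ} {ofℝ (normSq z)} {z * conj z} (ofℝ-* {ρ} {ρ} {normSq z} ρ²) norm)
       (ℂ-Ring.trans {ofℝ σ * ofℝ σ} {ofℝ ((ρ +ᴿ re z) +ᴿ (ρ +ᴿ re z))} {z + conj z + (ofℝ ρ + ofℝ ρ)}
         (ofℝ-* {σ} {σ} {(ρ +ᴿ re z) +ᴿ (ρ +ᴿ re z)} σ²) trace)
       (ofℝ-* {σ} {invᴿ σ σ>0} {fromℚᴿ 1ℚ} (*ᴿ-inverse σ σ>0))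
  where
  open +-*-Solver
  norm : ofℝ (normSq z) ≈ z * conj z
  norm =
    pointwise {normSq z} {re (z * conj z)} (λ n →
      solve 2 (λ a b → a :* a :+ b :* b := a :* a :- b :* (:- b)) refl (seq (re z) n) (seq (im z) n)) ,
    pointwise {fromℚᴿ 0ℚ} {im (z * conj z)} (λ n →
      solve 2 (λ a b → con 0ℚ := a :* (:- b) :+ b :* a) refl (seq (re z) n) (seq (im z) n))
  trace : ofℝ ((ρ +ᴿ re z) +ᴿ (ρ +ᴿ re z)) ≈ z + conj z + (ofℝ ρ + ofℝ ρ)
  trace =
    pointwise {(ρ +ᴿ re z) +ᴿ (ρ +ᴿ re z)} {re (z + conj z + (ofℝ ρ + ofℝ ρ))} (λ n →
      solve 2 (λ a r → (r :+ a) :+ (r :+ a) := (a :+ a) :+ (r :+ r)) refl (seq (re z) n) (seq ρ n)) ,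
    pointwise {fromℚᴿ 0ℚ} {im (z + conj z + (ofℝ ρ + ofℝ ρ))} (λ n →
      solve 1 (λ b → con 0ℚ := (b :+ (:- b)) :+ (con 0ℚ :+ con 0ℚ)) refl (seq (im z) n))

abstract
  -- Where `z` may be too close to the negative real axis, a root of its negative is taken and
  -- multiplied by `𝕚`.
  sqrtℂ : ∀ z → Nonzero z → ∃[ w ] w ² ≈ z
  sqrtℂ z z≠0 =
    let ρ , ρ>0 , ρ² = sqrtᴿ (normSq z) z≠0
    in choose ρ ρ² (r+a∨r-a>0 ρ (re z) ρ>0)
    where
    open +-*-Solver
    normSq-neg : normSq z ≈ᴿ normSq (-ᶜ z)
    normSq-neg = pointwise {normSq z} {normSq (-ᶜ z)} (λ n →
      solve 2 (λ a b → a :* a :+ b :* b := (:- a) :* (:- a) :+ (:- b) :* (:- b)) refl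
        (seq (re z) n) (seq (im z) n))
    𝕚 : ℂ
    𝕚 = fromℚᴿ 0ℚ +i fromℚᴿ 1ℚ
    𝕚*-² : ∀ w → (𝕚 * w) ² ≈ -ᶜ (w ²)
    𝕚*-² w =
      pointwise {re ((𝕚 * w) ²)} {re (-ᶜ (w ²))} (λ n →
        solve 2 (λ a b → (con 0ℚ :* a :- con 1ℚ :* b) :* (con 0ℚ :* a :- con 1ℚ :* b)
            :- (con 0ℚ :* b :+ con 1ℚ :* a) :* (con 0ℚ :* b :+ con 1ℚ :* a)
          := :- (a :* a :- b :* b)) refl (seq (re w) n) (seq (im w) n)) ,
      pointwise {im ((𝕚 * w) ²)} {im (-ᶜ (w ²))} (λ n →
        solve 2 (λ a b → (con 0ℚ :* a :- con 1ℚ :* b) :* (con 0ℚ :* b :+ con 1ℚ :* a)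
            :+ (con 0ℚ :* b :+ con 1ℚ :* a) :* (con 0ℚ :* a :- con 1ℚ :* b)
          := :- (a :* b :+ b :* a)) refl (seq (re w) n) (seq (im w) n))
    neg-neg : -ᶜ (-ᶜ z) ≈ z
    neg-neg = pointwise {re (-ᶜ (-ᶜ z))} {re z} (λ n → solve 1 (λ a → :- (:- a) := a) refl (seq (re z) n)) ,
              pointwise {im (-ᶜ (-ᶜ z))} {im z} (λ n → solve 1 (λ a → :- (:- a) := a) refl (seq (im z) n))
    choose : ∀ ρ → (ρ *ᴿ ρ) ≈ᴿ normSq z → Positiveᴿ (ρ +ᴿ re z) ⊎ Positiveᴿ (ρ -ᴿ re z) → ∃[ w ] w ² ≈ z
    choose ρ ρ² (inj₁ pos) = sqrt-right z ρ ρ² pos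
    choose ρ ρ² (inj₂ pos) =
      let w , w² = sqrt-right (-ᶜ z) ρ (≈ᴿ-trans {ρ *ᴿ ρ} {normSq z} {normSq (-ᶜ z)} ρ² normSq-neg) pos
      in 𝕚 * w ,
         ℂ-Ring.trans {(𝕚 * w) ²} { -ᶜ (w ²)} {z} (𝕚*-² w)
           (ℂ-Ring.trans { -ᶜ (w ²)} { -ᶜ (-ᶜ z)} {z} (ℂ-Ring.-‿cong {w ²} { -ᶜ z} w²) neg-neg)

-- The lattice equations over ℂ

⊕-identityʳ : ∀ v → v ⊕ (+ 0 , + 0) ≡ v
⊕-identityʳ (a , b) = cong₂ _,_ (ℤ.+-identityʳ a) (ℤ.+-identityʳ b)

≈-/ : ∀ {y n} d → val d * y ≈ n → y ≈ n / d
≈-/ {y} {n} d dy≈n = unit-cancelˡ {val d} {y} {n / d} (inv d , *-inv d) (begin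
  val d * y           ≈⟨ dy≈n ⟩
  n                   ≈⟨ *-identityʳ n ⟨
  n * 1ℂ              ≈⟨ *-congˡ {n} {val d * inv d} {1ℂ} (*-inv d) ⟨
  n * (val d * inv d) ≈⟨ x∙yz≈y∙xz n (val d) (inv d) ⟩
  val d * (n * inv d) ∎)
  where
  open CommutativeRing ℂ-commutativeRing using (setoid; *-identityʳ; *-congˡ; *-commutativeSemigroup)
  open Units ℂ-commutativeRing
  open CommutativeSemigroupProperties *-commutativeSemigroup using (x∙yz≈y∙xz)
  open SetoidReasoning setoid

/-≈ : ∀ {y n} d → y ≈ n / d → val d * y ≈ n
/-≈ {y} {n} d y≈n/d = begin
  val d * y           ≈⟨ *-congˡ {val d} {y} {n / d} y≈n/d ⟩
  val d * (n * inv d) ≈⟨ x∙yz≈y∙xz (val d) n (inv d) ⟩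
  n * (val d * inv d) ≈⟨ *-congˡ {n} {val d * inv d} {1ℂ} (*-inv d) ⟩
  n * 1ℂ              ≈⟨ *-identityʳ n ⟩
  n                   ∎
  where
  open CommutativeRing ℂ-commutativeRing using (setoid; *-identityʳ; *-congˡ; *-commutativeSemigroup)
  open CommutativeSemigroupProperties *-commutativeSemigroup using (x∙yz≈y∙xz)
  open SetoidReasoning setoid

-- The numbers are explicit because `≈` unfolds to a statement about sequences, from which their
-- Cauchy proofs cannot be inferred.
*-cong₄ : ∀ a a′ b b′ c c′ d d′ → a ≈ a′ → b ≈ b′ → c ≈ c′ → d ≈ d′ →
  a * b * c * d ≈ a′ * b′ * c′ * d′
*-cong₄ a a′ b b′ c c′ d d′ a≈a′ b≈b′ c≈c′ d≈d′ =
  *-cong {a * b * c} {a′ * b′ * c′} {d} {d′}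
    (*-cong {a * b} {a′ * b′} {c} {c′} (*-cong {a} {a′} {b} {b′} a≈a′ b≈b′) c≈c′) d≈d′
  where open CommutativeRing ℂ-commutativeRing using (*-cong)

module _ (α₁ α₂ : ℂ) (x : ℤ² → ℂˣ) where
  open CommutativeRing ℂ-commutativeRing using (+-group; +-congˡ)
    renaming (refl to ≈-refl; sym to ≈-sym; trans to ≈-trans)
  open Units ℂ-commutativeRing using (Unit; unit-resp)

  κ : ℂ
  κ = (α₂ ² - α₁ ²) / 4ˣ

  4κ : 4ℂ * κ ≈ α₂ ² - α₁ ²
  4κ = /-≈ {κ} {α₂ ² - α₁ ²} 4ˣ (CommutativeRing.refl ℂ-commutativeRing {κ})

  ℂˣ-unit : ∀ d → Unit (val d)
  ℂˣ-unit d = inv d , *-inv d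

  value : ℤ² → ℂ
  value v = val (x v)

  value-unit : ∀ v → Unit (value v)
  value-unit v = ℂˣ-unit (x v)

  open ℂ-Lattice.Field α₁ α₂ κ 4κ value value-unit (ℂˣ-unit 2ˣ) (ℂˣ-unit 4ˣ)

  point : ℤ² → Sign → Sign → ℕ → ℕ → ℤ²
  point u ε₁ ε₂ i j = u ⊕ (ε₁ ◃ i , ε₂ ◃ j)

  cornerAt : (p₀₀ p₁₀ p₀₁ p₁₁ p₀₂ p₁₂ : ℤ²) → ℂ
  cornerAt p₀₀ p₁₀ p₀₁ p₁₁ p₀₂ p₁₂ = ℂ-Lattice.corner α₁ α₂
    (value p₀₀) (value p₁₀) (value p₀₁) (value p₁₁) (value p₀₂) (value p₁₂)

  -- Stated with _≈_, since _≡_ would also equate the Cauchy proofs.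
  Rᴮ≈cornerAt : ∀ u ε₁ ε₂ {p₀₀ p₁₀ p₀₁ p₁₁ p₀₂ p₁₂} →
    point u ε₁ ε₂ 0 0 ≡ p₀₀ → point u ε₁ ε₂ 1 0 ≡ p₁₀ → point u ε₁ ε₂ 0 1 ≡ p₀₁ →
    point u ε₁ ε₂ 1 1 ≡ p₁₁ → point u ε₁ ε₂ 0 2 ≡ p₀₂ → point u ε₁ ε₂ 1 2 ≡ p₁₂ →
    Rᴮ α₁ α₂ x u ε₁ ε₂ ≈ cornerAt p₀₀ p₁₀ p₀₁ p₁₁ p₀₂ p₁₂
  Rᴮ≈cornerAt u ε₁ ε₂ ≡.refl ≡.refl ≡.refl ≡.refl ≡.refl ≡.refl = ≈-refl {Rᴮ α₁ α₂ x u ε₁ ε₂}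

  Rᴮ≈R₀₀ : ∀ v → Rᴮ α₁ α₂ x v Sign.+ Sign.+ ≈ R₀₀ v
  Rᴮ≈R₀₀ v = Rᴮ≈cornerAt v Sign.+ Sign.+ ≡.refl ≡.refl ≡.refl ≡.refl ≡.refl ≡.refl

  Rᴮ≈R₁₀ : ∀ v → Rᴮ α₁ α₂ x (v ⊕ e₁) Sign.- Sign.+ ≈ R₁₀ v
  Rᴮ≈R₁₀ v = Rᴮ≈cornerAt (v ⊕ e₁) Sign.- Sign.+
    (⊕-assoc v e₁ (+ 0 , + 0)) (⊕-assoc v e₁ (-[1+ 0 ] , + 0))
    (⊕-assoc v e₁ (+ 0 , + 1)) (⊕-assoc v e₁ (-[1+ 0 ] , + 1))
    (⊕-assoc v e₁ (+ 0 , + 2)) (⊕-assoc v e₁ (-[1+ 0 ] , + 2))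

  Rᴮ≈R₀₂ : ∀ v → Rᴮ α₁ α₂ x (v ⊕ (+ 0 , + 2)) Sign.+ Sign.- ≈ R₀₂ v
  Rᴮ≈R₀₂ v = Rᴮ≈cornerAt (v ⊕ (+ 0 , + 2)) Sign.+ Sign.-
    (⊕-assoc v (+ 0 , + 2) (+ 0 , + 0))      (⊕-assoc v (+ 0 , + 2) (+ 1 , + 0))
    (⊕-assoc v (+ 0 , + 2) (+ 0 , -[1+ 0 ])) (⊕-assoc v (+ 0 , + 2) (+ 1 , -[1+ 0 ]))
    (⊕-assoc v (+ 0 , + 2) (+ 0 , -[1+ 1 ])) (⊕-assoc v (+ 0 , + 2) (+ 1 , -[1+ 1 ]))

  Rᴮ≈R₁₂ : ∀ v → Rᴮ α₁ α₂ x (v ⊕ (+ 1 , + 2)) Sign.- Sign.- ≈ R₁₂ v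
  Rᴮ≈R₁₂ v = Rᴮ≈cornerAt (v ⊕ (+ 1 , + 2)) Sign.- Sign.-
    (⊕-assoc v (+ 1 , + 2) (+ 0 , + 0))      (⊕-assoc v (+ 1 , + 2) (-[1+ 0 ] , + 0))
    (⊕-assoc v (+ 1 , + 2) (+ 0 , -[1+ 0 ])) (⊕-assoc v (+ 1 , + 2) (-[1+ 0 ] , -[1+ 0 ]))
    (⊕-assoc v (+ 1 , + 2) (+ 0 , -[1+ 1 ])) (⊕-assoc v (+ 1 , + 2) (-[1+ 0 ] , -[1+ 1 ]))

  Rˢ≈S : ∀ {u v} → u ≡ v → Rˢ α₁ α₂ x u ≈ S v
  Rˢ≈S {u} ≡.refl = ≈-refl {Rˢ α₁ α₂ x u}

  Rᶜ≈C : ∀ {u v} → u ≡ v → Rᶜ α₁ α₂ x u ≈ C v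
  Rᶜ≈C {u} ≡.refl = ≈-refl {Rᶜ α₁ α₂ x u}

  product-lhs : ∀ v →
      Rᴮ α₁ α₂ x (v ⊕ e₁₂) Sign.+ Sign.+ * Rᴮ α₁ α₂ x (v ⊕ e₁₂) Sign.- Sign.+
    * Rᴮ α₁ α₂ x (v ⊕ e₁₂ ⊕ e₂) Sign.- Sign.- * Rᴮ α₁ α₂ x (v ⊕ e₁₂ ⊕ e₂) Sign.+ Sign.-
    ≈ R₀₀ (v ⊕ e₁₂) * R₁₀ (v ⊕ e₂) * R₁₂ v * R₀₂ (v ⊕ e₁)
  product-lhs v = *-cong₄
    (Rᴮ α₁ α₂ x (v ⊕ e₁₂) Sign.+ Sign.+) (R₀₀ (v ⊕ e₁₂))
    (Rᴮ α₁ α₂ x (v ⊕ e₁₂) Sign.- Sign.+) (R₁₀ (v ⊕ e₂))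
    (Rᴮ α₁ α₂ x (v ⊕ e₁₂ ⊕ e₂) Sign.- Sign.-) (R₁₂ v)
    (Rᴮ α₁ α₂ x (v ⊕ e₁₂ ⊕ e₂) Sign.+ Sign.-) (R₀₂ (v ⊕ e₁))
    (Rᴮ≈R₀₀ (v ⊕ e₁₂))
    (subst (λ u → Rᴮ α₁ α₂ x u Sign.- Sign.+ ≈ R₁₀ (v ⊕ e₂)) (⊕-assoc v e₂ e₁) (Rᴮ≈R₁₀ (v ⊕ e₂)))
    (subst (λ u → Rᴮ α₁ α₂ x u Sign.- Sign.- ≈ R₁₂ v) (≡.sym (⊕-assoc v e₁₂ e₂)) (Rᴮ≈R₁₂ v))
    (subst (λ u → Rᴮ α₁ α₂ x u Sign.+ Sign.- ≈ R₀₂ (v ⊕ e₁))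
      (≡.trans (⊕-assoc v e₁ (+ 0 , + 2)) (≡.sym (⊕-assoc v e₁₂ e₂))) (Rᴮ≈R₀₂ (v ⊕ e₁)))

  product-rhs : ∀ v →
      Rˢ α₁ α₂ x (v ⊕ e₁₂) * Rˢ α₁ α₂ x (v ⊕ e₁₂ ⊕ (+ 0 , -[1+ 0 ]))
    * Rᶜ α₁ α₂ x (v ⊕ e₁₂) * Rᶜ α₁ α₂ x (v ⊕ e₁₂ ⊕ (-[1+ 0 ] , + 0))
    ≈ S (v ⊕ e₁₂) * S (v ⊕ e₁) * C (v ⊕ e₁₂) * C (v ⊕ e₂)
  product-rhs v = *-cong₄
    (Rˢ α₁ α₂ x (v ⊕ e₁₂)) (S (v ⊕ e₁₂))
    (Rˢ α₁ α₂ x (v ⊕ e₁₂ ⊕ (+ 0 , -[1+ 0 ]))) (S (v ⊕ e₁))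
    (Rᶜ α₁ α₂ x (v ⊕ e₁₂)) (C (v ⊕ e₁₂))
    (Rᶜ α₁ α₂ x (v ⊕ e₁₂ ⊕ (-[1+ 0 ] , + 0))) (C (v ⊕ e₂))
    (Rˢ≈S {v ⊕ e₁₂} ≡.refl)
    (Rˢ≈S (⊕-assoc v e₁₂ (+ 0 , -[1+ 0 ])))
    (Rᶜ≈C {v ⊕ e₁₂} ≡.refl)
    (Rᶜ≈C (⊕-assoc v e₁₂ (-[1+ 0 ] , + 0)))

  product⇔corner : ∀ v →
    (ProductIdentity α₁ α₂ x (v ⊕ e₁₂) → CornerProduct v) ×
    (CornerProduct v → ProductIdentity α₁ α₂ x (v ⊕ e₁₂))
  product⇔corner v =
    (λ r≈s → ≈-trans {r′} {r} {s′} (≈-sym {r} {r′} (product-lhs v))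
      (≈-trans {r} {s} {s′} r≈s (product-rhs v))) ,
    (λ r′≈s′ → ≈-trans {r} {r′} {s} (product-lhs v)
      (≈-trans {r′} {s′} {s} r′≈s′ (≈-sym {s} {s′} (product-rhs v))))
    where
    r r′ s s′ : ℂ
    r = Rᴮ α₁ α₂ x (v ⊕ e₁₂) Sign.+ Sign.+ * Rᴮ α₁ α₂ x (v ⊕ e₁₂) Sign.- Sign.+
      * Rᴮ α₁ α₂ x (v ⊕ e₁₂ ⊕ e₂) Sign.- Sign.- * Rᴮ α₁ α₂ x (v ⊕ e₁₂ ⊕ e₂) Sign.+ Sign.-
    r′ = R₀₀ (v ⊕ e₁₂) * R₁₀ (v ⊕ e₂) * R₁₂ v * R₀₂ (v ⊕ e₁)
    s = Rˢ α₁ α₂ x (v ⊕ e₁₂) * Rˢ α₁ α₂ x (v ⊕ e₁₂ ⊕ (+ 0 , -[1+ 0 ]))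
      * Rᶜ α₁ α₂ x (v ⊕ e₁₂) * Rᶜ α₁ α₂ x (v ⊕ e₁₂ ⊕ (-[1+ 0 ] , + 0))
    s′ = S (v ⊕ e₁₂) * S (v ⊕ e₁) * C (v ⊕ e₁₂) * C (v ⊕ e₂)

  module _ (y₁ : ℤ² → ℂ) (y₂ : ℤ²½ → ℂ) where

    rest : ℤ² → ℂ
    rest v = α₁ * z v 1 0 * z v 0 1 ² + 2ℂ * z v 0 0 * z v 1 0 * z v 0 2 + α₂ * z v 0 0 * z v 0 1 * z v 1 1

    2z²z₁₂ : ∀ v → 2ℂ * z v 0 0 ² * z v 1 2 ≈ rest v + R₀₀ v
    2z²z₁₂ v = ℂ-Lattice.leading-term α₁ α₂ (z v 0 0) (z v 1 0) (z v 0 1) (z v 1 1) (z v 0 2) (z v 1 2)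

    module _ (v : ℤ²) where
      private
        a b a₁ b₂ : ℂ
        a  = y₁ (v ⊕ e₂)
        b  = y₂ (v +½½)
        a₁ = y₁ (v ⊕ e₁₂)
        b₂ = y₂ ((v ⊕ e₂) +½½)
        z₀₀ 2z₀₀² : ℂˣ
        z₀₀ = x (v ⊕ (+ 0 , + 0))
        2z₀₀² = 2ˣ *ˣ (z₀₀ *ˣ z₀₀)

      solves⇒system : Solves v a b a₁ b₂ → System α₁ α₂ x y₁ y₂ v
      solves⇒system s = record
        { z₁₂-eq = ≈-/ {z v 1 2} {rest v + a * b} 2z₀₀²
            (≈-trans {2ℂ * z v 0 0 ² * z v 1 2} {rest v + R₀₀ v} {rest v + a * b} (2z²z₁₂ v)
              (+-congˡ {rest v} {R₀₀ v} {a * b} (≈-sym {a * b} {R₀₀ v} ab-eq)))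
        ; w₁₁-eq = ≈-/ {a₁} {z v 1 0 * a + b} z₀₀ a-step
        ; w½³⁄₂-eq = ≈-/ {b₂} {A v * a + B v * b} 2z₀₀² b-step
        ; w₀₁²-eq = a²-eq
        ; w½½²-eq = b²-eq
        }
        where open Solves s

      system⇒solves : System α₁ α₂ x y₁ y₂ v → Solves v a b a₁ b₂
      system⇒solves s = record
        { ab-eq = GroupProperties.∙-cancelˡ +-group (rest v) (a * b) (R₀₀ v)
            (≈-trans {rest v + a * b} {2ℂ * z v 0 0 ² * z v 1 2} {rest v + R₀₀ v}
              (≈-sym {2ℂ * z v 0 0 ² * z v 1 2} {rest v + a * b}
                (/-≈ {z v 1 2} {rest v + a * b} 2z₀₀² z₁₂-eq))
              (2z²z₁₂ v))
        ; a-step = /-≈ {a₁} {z v 1 0 * a + b} z₀₀ w₁₁-eq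
        ; b-step = /-≈ {b₂} {A v * a + B v * b} 2z₀₀² w½³⁄₂-eq
        ; a²-eq = w₀₁²-eq
        ; b²-eq = w½½²-eq
        }
        where open System s

  Quartic⇒F≈0 : ∀ v → Quartic α₁ α₂ x v → F v ≈ 0ℂ
  Quartic⇒F≈0 v = ≈-sym {0ℂ} {F v}

  S-unit : ∀ v → Nonzero (Rˢ α₁ α₂ x v) → Unit (S v)
  S-unit v Rˢ≠0 = unit-resp {Rˢ α₁ α₂ x v} {S v} (Rˢ≈S {v} ≡.refl) (ℂˣ-unit (mkℂˣ (Rˢ α₁ α₂ x v) Rˢ≠0))

  C-unit : ∀ v → Nonzero (Rᶜ α₁ α₂ x v) → Unit (C v)
  C-unit v Rᶜ≠0 = unit-resp {Rᶜ α₁ α₂ x v} {C v} (Rᶜ≈C {v} ≡.refl) (ℂˣ-unit (mkℂˣ (Rᶜ α₁ α₂ x v) Rᶜ≠0))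

  S-root : ∀ v → Nonzero (Rˢ α₁ α₂ x v) → ∃[ r ] r ² ≈ S v
  S-root v Rˢ≠0 = map₂
    (λ {r} r² → ≈-trans {r ²} {Rˢ α₁ α₂ x v} {S v} r² (Rˢ≈S {v} ≡.refl))
    (sqrtℂ (Rˢ α₁ α₂ x v) Rˢ≠0)

  lattice-solution :
    (∀ v → Quartic α₁ α₂ x v) → (∀ v → ProductIdentity α₁ α₂ x v) →
    (∀ v → Nonzero (Rˢ α₁ α₂ x v)) → (∀ v → Nonzero (Rᶜ α₁ α₂ x v)) →
    ∃[ a ] ∃[ b ] Solution a b
  lattice-solution quartic product Rˢ≠0 Rᶜ≠0 = Existence.solution
      (λ v → Quartic⇒F≈0 v (quartic v))
      (λ v → proj₁ (product⇔corner v) (product (v ⊕ e₁₂)))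
      (λ v → S-unit v (Rˢ≠0 v))
      (λ v → C-unit v (Rᶜ≠0 v))
      (S-root (+ 0 , + 0) (Rˢ≠0 (+ 0 , + 0)))

  solution⇒system : ∃[ a ] ∃[ b ] Solution a b →
    ∃[ y₁ ] ∃[ y₂ ] (∀ v → System α₁ α₂ x y₁ y₂ v)
  solution⇒system (a , b , solution) = y₁ , y₂ , λ v →
    solves⇒system y₁ y₂ v
      (subst₂ (λ u w → Solves v (a u) (b v) (a w) (b (v ⊕ e₂)))
        (≡.sym (≡.trans (⊕-assoc v e₂ (+ 0 , -[1+ 0 ])) (⊕-identityʳ v)))
        (≡.sym (⊕-assoc v e₁₂ (+ 0 , -[1+ 0 ])))
        (solution v))
    where
    -- `a v` belongs to the segment starting at `v`, while `System` indexes it by the midpoint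
    -- `v ⊕ e₂`.
    y₁ : ℤ² → ℂ
    y₁ v = a (v ⊕ (+ 0 , -[1+ 0 ]))
    y₂ : ℤ²½ → ℂ
    y₂ (v +½½) = b v

  existence :
    (∀ v → Quartic α₁ α₂ x v) → (∀ v → ProductIdentity α₁ α₂ x v) →
    (∀ v → Nonzero (Rˢ α₁ α₂ x v)) → (∀ v → Nonzero (Rᶜ α₁ α₂ x v)) →
    ∃[ y₁ ] ∃[ y₂ ] (∀ v → System α₁ α₂ x y₁ y₂ v)
  existence quartic product Rˢ≠0 Rᶜ≠0 =
    solution⇒system (lattice-solution quartic product Rˢ≠0 Rᶜ≠0)

  converse : ∀ y₁ y₂ → (∀ v → System α₁ α₂ x y₁ y₂ v) →
    (∀ v → Quartic α₁ α₂ x v) × (∀ v → ProductIdentity α₁ α₂ x v)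
  converse y₁ y₂ system =
    (λ v → ≈-sym {F v} {0ℂ} (F≈0 v)) ,
    -- `CornerProduct` speaks of the point one diagonal step further, so it is used at `v` shifted
    -- back by `e₁₂`.
    (λ v → subst (ProductIdentity α₁ α₂ x)
      (≡.trans (⊕-assoc v (-[1+ 0 ] , -[1+ 0 ]) e₁₂) (⊕-identityʳ v))
      (proj₂ (product⇔corner (v ⊕ (-[1+ 0 ] , -[1+ 0 ]))) (product (v ⊕ (-[1+ 0 ] , -[1+ 0 ])))))
    where
    a b : ℤ² → ℂ
    a v = y₁ (v ⊕ e₂)
    b v = y₂ (v +½½)
    solution : Solution a b
    solution v = subst (λ u → Solves v (a v) (b v) (y₁ u) (b (v ⊕ e₂)))
      (≡.sym (⊕-assoc v e₁ e₂)) (system⇒solves y₁ y₂ v (system v))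
    open Converse a b solution

theorem6p10 : (α₁ α₂ : ℂ) →
    ( (x : ℤ² → ℂˣ) →
    (∀ v → Quartic α₁ α₂ x v) →
    (∀ v → ProductIdentity α₁ α₂ x v) →
    (∀ v → Nonzero (Rˢ α₁ α₂ x v)) →
    (∀ v → Nonzero (Rᶜ α₁ α₂ x v)) →
    ∃[ y₁ ] ∃[ y₂ ] (∀ v → System α₁ α₂ x y₁ y₂ v) )
    ×
    ( (x : ℤ² → ℂˣ) (y₁ : ℤ² → ℂ) (y₂ : ℤ²½ → ℂ) →
    (∀ v → System α₁ α₂ x y₁ y₂ v) →
    (∀ v → Quartic α₁ α₂ x v) × (∀ v → ProductIdentity α₁ α₂ x v) )
theorem6p10 α₁ α₂ = existence α₁ α₂ , converse α₁ α₂
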